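{- Let $G$ be a Dedekind $\sigma$-complete $\ell$-group with weak unit $1$. Then there exist a set $X$, a $\sigma$-ideal $\mathcal{I}$ of subsets of $X$ and an injective $\sigma$-continuous $\ell$-homomorphism $\iota\colon G\hookrightarrow\frac{\mathbb{R}^X}{\mathcal{I}}$ such that $\iota(1)=[1]_{\mathcal{I}}$.
   Context: An $\ell$-group is a lattice-ordered group; a Dedekind $\sigma$-complete $\ell$-group is automatically archimedean, hence abelian. A poset is Dedekind $\sigma$-complete if every nonempty countable subset that has an upper bound has a supremum. An element $1$ of an abelian $\ell$-group $G$ is a weak unit if $1\geq0$ and, for every $f\in G$, $f\land1=0$ implies $f=0$. A map between posets is $\sigma$-continuous if it preserves all existing suprema of nonempty countable subsets. An $\ell$-homomorphism is a group homomorphism that is a lattice homomorphism. A $\sigma$-ideal of subsets of $X$ is a set $\mathcal{I}$ of subsets of $X$ containing $\emptyset$, closed under taking subsets and under countable unions ($X\in\mathcal{I}$ is allowed). $\frac{\mathbb{R}^X}{\mathcal{I}}$ is the quotient of $\mathbb{R}^X$ by the relation $f\sim g$ iff $\{x\in X\mid f(x)\neq g(x)\}\in\mathcal{I}$, with operations (and order) induced from the pointwise ones; $[f]_{\mathcal{I}}$ is the class of $f$, and $[1]_{\mathcal{I}}$ is the class of the constant function $1$. -}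

module Defs where

open import Level using (Level; _⊔_; suc; 0ℓ)
open import Algebra.Bundles.Raw using (RawGroup)
open import Algebra.Core using (Op₁; Op₂)
open import Algebra.Lattice.Bundles.Raw using (RawLattice)
open import Algebra.Lattice.Morphism.Structures using (IsLatticeHomomorphism)
open import Algebra.Morphism.Structures using (IsGroupHomomorphism)
open import Algebra.Structures using (IsGroup)
open import Axiom.ExcludedMiddle using (ExcludedMiddle)
open import Data.Nat.Base as ℕ using (ℕ)
import Data.Nat.Properties as ℕ
open import Data.Product.Base using (∃; _×_; _,_)
open import Data.Rational.Base as ℚ using (ℚ; 0ℚ; 1ℚ; ½; ∣_∣)
import Data.Rational.Properties as ℚ
open import Data.Rational.Solver using (module +-*-Solver)
open import Data.Sum.Base using (inj₁; inj₂)
open import Function.Base using (_∘_)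
open import Relation.Binary.Bundles using (Poset)
open import Relation.Binary.Core using (Rel)
open import Relation.Binary.Lattice.Structures using (IsLattice)
open import Relation.Binary.PropositionalEquality
  using (_≡_; refl; sym; trans; cong; subst; subst₂)
open import Relation.Binary.Structures using (IsEquivalence)
open import Relation.Nullary using (¬_; yes; no)
open import Relation.Unary using (Pred; _⊆_; ∅; ⋃)

private
  variable
    a b c ℓ ℓ₁ ℓ₂ ℓ₃ ℓ₄ : Level

-- A nonempty countable subset of a poset is presented as the range of a
-- sequence.

module _ (P : Poset c ℓ₁ ℓ₂) where
  open Poset P

  IsUpperBound : (ℕ → Carrier) → Pred Carrier ℓ₂
  IsUpperBound f u = ∀ n → f n ≤ u

  IsSupremum : (ℕ → Carrier) → Pred Carrier (c ⊔ ℓ₂)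
  IsSupremum f s = IsUpperBound f s × (∀ u → IsUpperBound f u → s ≤ u)

  DedekindσComplete : Set (c ⊔ ℓ₂)
  DedekindσComplete = ∀ f → ∃ (IsUpperBound f) → ∃ (IsSupremum f)

module _ (P : Poset a ℓ₁ ℓ₂) (Q : Poset b ℓ₃ ℓ₄) where

  σ-Continuous : (Poset.Carrier P → Poset.Carrier Q) → Set (a ⊔ b ⊔ ℓ₂ ⊔ ℓ₄)
  σ-Continuous h = ∀ f s → IsSupremum P f s → IsSupremum Q (h ∘ f) (h s)

-- Written additively, but not assumed commutative.

record ℓ-Group (c ℓ₁ ℓ₂ : Level) : Set (suc (c ⊔ ℓ₁ ⊔ ℓ₂)) where
  infix  4 _≈_ _≤_
  infixl 6 _+_
  infixr 6 _∨_
  infixr 7 _∧_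
  infix  8 -_
  field
    Carrier   : Set c
    _≈_       : Rel Carrier ℓ₁
    _≤_       : Rel Carrier ℓ₂
    _+_       : Op₂ Carrier
    0#        : Carrier
    -_        : Op₁ Carrier
    _∨_       : Op₂ Carrier
    _∧_       : Op₂ Carrier
    isGroup   : IsGroup _≈_ _+_ 0# -_
    isLattice : IsLattice _≈_ _≤_ _∨_ _∧_
    +-monoʳ-≤ : ∀ z {x y} → x ≤ y → z + x ≤ z + y
    +-monoˡ-≤ : ∀ z {x y} → x ≤ y → x + z ≤ y + z

  rawGroup : RawGroup c ℓ₁
  rawGroup = record { _≈_ = _≈_ ; _∙_ = _+_ ; ε = 0# ; _⁻¹ = -_ }

  rawLattice : RawLattice c ℓ₁
  rawLattice = record { _≈_ = _≈_ ; _∧_ = _∧_ ; _∨_ = _∨_ }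

  poset : Poset c ℓ₁ ℓ₂
  poset = record { isPartialOrder = IsLattice.isPartialOrder isLattice }

module _ (G : ℓ-Group c ℓ₁ ℓ₂) where
  open ℓ-Group G

  IsWeakUnit : Pred Carrier (c ⊔ ℓ₁ ⊔ ℓ₂)
  IsWeakUnit u = 0# ≤ u × (∀ f → f ∧ u ≈ 0# → f ≈ 0#)

module _ (G : ℓ-Group a ℓ₁ ℓ₂) (H : ℓ-Group b ℓ₃ ℓ₄) where
  private
    module G = ℓ-Group G
    module H = ℓ-Group H

  record Isℓ-Homomorphism (h : G.Carrier → H.Carrier) : Set (a ⊔ ℓ₁ ⊔ ℓ₃) where
    field
      isGroupHomomorphism   : IsGroupHomomorphism G.rawGroup H.rawGroup h
      isLatticeHomomorphism : IsLatticeHomomorphism G.rawLattice H.rawLattice h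

-- Real numbers are Cauchy sequences of rationals; equality of reals is _≈ʳ_.

record ℝ : Set where
  constructor mkℝ
  field
    seq    : ℕ → ℚ
    cauchy : ∀ ε → 0ℚ ℚ.< ε →
             ∃ λ N → ∀ m n → N ℕ.≤ m → N ℕ.≤ n → ∣ seq m ℚ.- seq n ∣ ℚ.< ε

open ℝ public

infix 4 _≈ʳ_ _≤ʳ_

_≈ʳ_ : Rel ℝ 0ℓ
x ≈ʳ y = ∀ ε → 0ℚ ℚ.< ε →
         ∃ λ N → ∀ n → N ℕ.≤ n → ∣ seq x n ℚ.- seq y n ∣ ℚ.< ε

_≤ʳ_ : Rel ℝ 0ℓ
x ≤ʳ y = ∀ ε → 0ℚ ℚ.< ε →
         ∃ λ N → ∀ n → N ℕ.≤ n → seq x n ℚ.< seq y n ℚ.+ ε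

private
  open +-*-Solver using (solve; _:=_; _:+_; _:-_; :-_)

  p≡p-q+q : ∀ p q → p ≡ (p ℚ.- q) ℚ.+ q
  p≡p-q+q = solve 2 (λ p q → p := (p :- q) :+ q) refl

  p≤∣p∣ : ∀ p → p ℚ.≤ ∣ p ∣
  p≤∣p∣ p with ℚ.≤-total 0ℚ p
  ... | inj₁ 0≤p = ℚ.≤-reflexive (sym (ℚ.0≤p⇒∣p∣≡p 0≤p))
  ... | inj₂ p≤0 = ℚ.≤-trans p≤0 (ℚ.0≤∣p∣ p)

  ∣-∣-swap : ∀ p q → ∣ p ℚ.- q ∣ ≡ ∣ q ℚ.- p ∣
  ∣-∣-swap p q = trans (sym (ℚ.∣-p∣≡∣p∣ (p ℚ.- q)))
    (cong ∣_∣ (solve 2 (λ p q → :- (p :- q) := q :- p) refl p q))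

  ∣∣<⇒< : ∀ p q {ε} → ∣ p ℚ.- q ∣ ℚ.< ε → p ℚ.< q ℚ.+ ε
  ∣∣<⇒< p q {ε} h = subst₂ ℚ._<_ (sym (p≡p-q+q p q)) (ℚ.+-comm ε q)
    (ℚ.+-monoˡ-< q (ℚ.≤-<-trans (p≤∣p∣ (p ℚ.- q)) h))

  ∣∣<⇒> : ∀ p q {ε} → ∣ p ℚ.- q ∣ ℚ.< ε → q ℚ.< p ℚ.+ ε
  ∣∣<⇒> p q {ε} h = ∣∣<⇒< q p (subst (ℚ._< ε) (∣-∣-swap p q) h)

  <⇒-< : ∀ p q {ε} → p ℚ.< q ℚ.+ ε → p ℚ.- q ℚ.< ε
  <⇒-< p q {ε} h = subst (p ℚ.- q ℚ.<_)
    (solve 2 (λ q ε → (q :+ ε) :- q := ε) refl q ε) (ℚ.+-monoˡ-< (ℚ.- q) h)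

  <⇒∣∣< : ∀ p q {ε} → p ℚ.< q ℚ.+ ε → q ℚ.< p ℚ.+ ε → ∣ p ℚ.- q ∣ ℚ.< ε
  <⇒∣∣< p q {ε} p<q q<p with ℚ.∣p∣≡p∨∣p∣≡-p (p ℚ.- q)
  ... | inj₁ eq = subst (ℚ._< ε) (sym eq) (<⇒-< p q p<q)
  ... | inj₂ eq = subst (ℚ._< ε)
    (sym (trans eq (solve 2 (λ p q → :- (p :- q) := q :- p) refl p q)))
    (<⇒-< q p q<p)

  half+half : ∀ ε → ½ ℚ.* ε ℚ.+ ½ ℚ.* ε ≡ ε
  half+half ε = trans (sym (ℚ.*-distribʳ-+ ε ½ ½)) (ℚ.*-identityˡ ε)

  0<half : ∀ {ε} → 0ℚ ℚ.< ε → 0ℚ ℚ.< ½ ℚ.* ε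
  0<half {ε} h = subst (ℚ._< ½ ℚ.* ε) (ℚ.*-zeroʳ ½) (ℚ.*-monoʳ-<-pos ½ h)

  p<p+ε : ∀ p {ε} → 0ℚ ℚ.< ε → p ℚ.< p ℚ.+ ε
  p<p+ε p {ε} h = subst (ℚ._< p ℚ.+ ε) (ℚ.+-identityʳ p) (ℚ.+-monoʳ-< p h)

  <-step : ∀ {p q r} ε → p ℚ.< q ℚ.+ ½ ℚ.* ε → q ℚ.< r ℚ.+ ½ ℚ.* ε → p ℚ.< r ℚ.+ ε
  <-step {p} {q} {r} ε h k = subst (p ℚ.<_)
    (trans (ℚ.+-assoc r (½ ℚ.* ε) (½ ℚ.* ε)) (cong (r ℚ.+_) (half+half ε)))
    (ℚ.<-trans h (ℚ.+-monoˡ-< (½ ℚ.* ε) k))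

  +-step : ∀ p q r s ε → p ℚ.< r ℚ.+ ½ ℚ.* ε → q ℚ.< s ℚ.+ ½ ℚ.* ε →
           p ℚ.+ q ℚ.< (r ℚ.+ s) ℚ.+ ε
  +-step p q r s ε h k = subst (p ℚ.+ q ℚ.<_)
    (trans
      (solve 3 (λ r s e → (r :+ e) :+ (s :+ e) := (r :+ s) :+ (e :+ e)) refl r s (½ ℚ.* ε))
      (cong (r ℚ.+ s ℚ.+_) (half+half ε)))
    (ℚ.+-mono-< h k)

  neg-step : ∀ p q ε → q ℚ.< p ℚ.+ ε → ℚ.- p ℚ.< ℚ.- q ℚ.+ ε
  neg-step p q ε h = subst₂ ℚ._<_
    (solve 2 (λ p q → q :+ (:- p :- q) := :- p) refl p q)
    (solve 3 (λ p q e → (p :+ e) :+ (:- p :- q) := :- q :+ e) refl p q ε)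
    (ℚ.+-monoˡ-< (ℚ.- p ℚ.- q) h)

  ⊔-lub-< : ∀ {p q r} → p ℚ.< r → q ℚ.< r → p ℚ.⊔ q ℚ.< r
  ⊔-lub-< {p} {q} {r} h k with ℚ.⊔-sel p q
  ... | inj₁ eq = subst (ℚ._< r) (sym eq) h
  ... | inj₂ eq = subst (ℚ._< r) (sym eq) k

  ⊓-glb-<+ : ∀ {p q r ε} → p ℚ.< q ℚ.+ ε → p ℚ.< r ℚ.+ ε → p ℚ.< q ℚ.⊓ r ℚ.+ ε
  ⊓-glb-<+ {p} {q} {r} {ε} h k with ℚ.⊓-sel q r
  ... | inj₁ eq = subst (λ t → p ℚ.< t ℚ.+ ε) (sym eq) h
  ... | inj₂ eq = subst (λ t → p ℚ.< t ℚ.+ ε) (sym eq) k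

  ⊔-step : ∀ p q r s ε → p ℚ.< r ℚ.+ ε → q ℚ.< s ℚ.+ ε → p ℚ.⊔ q ℚ.< r ℚ.⊔ s ℚ.+ ε
  ⊔-step p q r s ε h k = ⊔-lub-<
    (ℚ.<-≤-trans h (ℚ.+-monoˡ-≤ ε (ℚ.p≤p⊔q r s)))
    (ℚ.<-≤-trans k (ℚ.+-monoˡ-≤ ε (ℚ.p≤q⊔p r s)))

  ⊓-step : ∀ p q r s ε → p ℚ.< r ℚ.+ ε → q ℚ.< s ℚ.+ ε → p ℚ.⊓ q ℚ.< r ℚ.⊓ s ℚ.+ ε
  ⊓-step p q r s ε h k = ⊓-glb-<+ {q = r} {r = s}
    (ℚ.≤-<-trans (ℚ.p⊓q≤p p q) h)
    (ℚ.≤-<-trans (ℚ.p⊓q≤q p q) k)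

  ⊔-left : ∀ {k l m} → k ℕ.⊔ l ℕ.≤ m → k ℕ.≤ m
  ⊔-left {k} {l} = ℕ.m⊔n≤o⇒m≤o k l

  ⊔-right : ∀ {k l m} → k ℕ.⊔ l ℕ.≤ m → l ℕ.≤ m
  ⊔-right {k} {l} = ℕ.m⊔n≤o⇒n≤o k l

  cauchy₂ : (_∙_ : Op₂ ℚ) (δ : ℚ → ℚ) → (∀ {ε} → 0ℚ ℚ.< ε → 0ℚ ℚ.< δ ε) →
            (∀ p q r s ε → p ℚ.< r ℚ.+ δ ε → q ℚ.< s ℚ.+ δ ε → (p ∙ q) ℚ.< (r ∙ s) ℚ.+ ε) →
            ∀ x y ε → 0ℚ ℚ.< ε →
            ∃ λ N → ∀ m n → N ℕ.≤ m → N ℕ.≤ n →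
            ∣ (seq x m ∙ seq y m) ℚ.- (seq x n ∙ seq y n) ∣ ℚ.< ε
  cauchy₂ _∙_ δ δ-pos step x y ε 0<ε
    with cauchy x (δ ε) (δ-pos 0<ε) | cauchy y (δ ε) (δ-pos 0<ε)
  ... | M , hx | N , hy = M ℕ.⊔ N , λ m n lm ln →
    let h = hx m n (⊔-left lm) (⊔-left ln)
        k = hy m n (⊔-right {M} lm) (⊔-right {M} ln)
        xm = seq x m ; xn = seq x n ; ym = seq y m ; yn = seq y n
    in <⇒∣∣< (xm ∙ ym) (xn ∙ yn)
         (step xm ym xn yn ε (∣∣<⇒< xm xn h) (∣∣<⇒< ym yn k))
         (step xn yn xm ym ε (∣∣<⇒> xm xn h) (∣∣<⇒> ym yn k))

infixl 6 _+ʳ_ _⊔ʳ_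
infixl 7 _⊓ʳ_
infix  8 -ʳ_

fromℚ : ℚ → ℝ
fromℚ q = mkℝ (λ _ → q) λ ε 0<ε → 0 , λ _ _ _ _ →
  <⇒∣∣< q q (p<p+ε q 0<ε) (p<p+ε q 0<ε)

0ʳ 1ʳ : ℝ
0ʳ = fromℚ 0ℚ
1ʳ = fromℚ 1ℚ

_+ʳ_ _⊔ʳ_ _⊓ʳ_ : Op₂ ℝ
x +ʳ y = mkℝ (λ n → seq x n ℚ.+ seq y n) (cauchy₂ ℚ._+_ (½ ℚ.*_) 0<half +-step x y)
x ⊔ʳ y = mkℝ (λ n → seq x n ℚ.⊔ seq y n) (cauchy₂ ℚ._⊔_ (λ ε → ε) (λ h → h) ⊔-step x y)
x ⊓ʳ y = mkℝ (λ n → seq x n ℚ.⊓ seq y n) (cauchy₂ ℚ._⊓_ (λ ε → ε) (λ h → h) ⊓-step x y)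

-ʳ_ : Op₁ ℝ
-ʳ x = mkℝ (λ n → ℚ.- seq x n) λ ε 0<ε →
  let N , h = cauchy x ε 0<ε in N , λ m n lm ln →
    let k = h m n lm ln in
    <⇒∣∣< (ℚ.- seq x m) (ℚ.- seq x n)
      (neg-step (seq x m) (seq x n) ε (∣∣<⇒> (seq x m) (seq x n) k))
      (neg-step (seq x n) (seq x m) ε (∣∣<⇒< (seq x m) (seq x n) k))

≈ʳ⇒≤ʳ : ∀ {x y} → x ≈ʳ y → x ≤ʳ y
≈ʳ⇒≤ʳ {x} {y} h ε 0<ε = let N , k = h ε 0<ε in
  N , λ n l → ∣∣<⇒< (seq x n) (seq y n) (k n l)

≤ʳ-antisym : ∀ {x y} → x ≤ʳ y → y ≤ʳ x → x ≈ʳ y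
≤ʳ-antisym {x} {y} h k ε 0<ε =
  let M , h′ = h ε 0<ε ; N , k′ = k ε 0<ε in
  M ℕ.⊔ N , λ n l →
    <⇒∣∣< (seq x n) (seq y n) (h′ n (⊔-left l)) (k′ n (⊔-right {M} l))

≤ʳ-trans : ∀ {x y z} → x ≤ʳ y → y ≤ʳ z → x ≤ʳ z
≤ʳ-trans {x} {y} {z} h k ε 0<ε =
  let M , h′ = h (½ ℚ.* ε) (0<half 0<ε) ; N , k′ = k (½ ℚ.* ε) (0<half 0<ε) in
  M ℕ.⊔ N , λ n l →
    <-step {seq x n} {seq y n} {seq z n} ε (h′ n (⊔-left l)) (k′ n (⊔-right {M} l))

≈ʳ-sym : ∀ {x y} → x ≈ʳ y → y ≈ʳ x
≈ʳ-sym {x} {y} h ε 0<ε = let N , k = h ε 0<ε in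
  N , λ n l → subst (ℚ._< ε) (∣-∣-swap (seq x n) (seq y n)) (k n l)

≈ʳ-trans : ∀ {x y z} → x ≈ʳ y → y ≈ʳ z → x ≈ʳ z
≈ʳ-trans {x} {y} {z} h k = ≤ʳ-antisym {x} {z}
  (≤ʳ-trans {x} {y} {z} (≈ʳ⇒≤ʳ {x} {y} h) (≈ʳ⇒≤ʳ {y} {z} k))
  (≤ʳ-trans {z} {y} {x} (≈ʳ⇒≤ʳ {z} {y} (≈ʳ-sym {y} {z} k)) (≈ʳ⇒≤ʳ {y} {x} (≈ʳ-sym {x} {y} h)))

private
  pointwise-≤ : ∀ {x y} → (∀ n → seq x n ℚ.≤ seq y n) → x ≤ʳ y
  pointwise-≤ {x} {y} h ε 0<ε = 0 , λ n _ → ℚ.≤-<-trans (h n) (p<p+ε (seq y n) 0<ε)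

  pointwise-≈ : ∀ {x y} → (∀ n → seq x n ≡ seq y n) → x ≈ʳ y
  pointwise-≈ {x} {y} h = ≤ʳ-antisym {x} {y}
    (pointwise-≤ {x} {y} λ n → ℚ.≤-reflexive (h n))
    (pointwise-≤ {y} {x} λ n → ℚ.≤-reflexive (sym (h n)))

  +ʳ-mono : ∀ {x y u v} → x ≤ʳ y → u ≤ʳ v → x +ʳ u ≤ʳ y +ʳ v
  +ʳ-mono {x} {y} {u} {v} h k ε 0<ε =
    let M , h′ = h (½ ℚ.* ε) (0<half 0<ε) ; N , k′ = k (½ ℚ.* ε) (0<half 0<ε) in
    M ℕ.⊔ N , λ n l →
      +-step (seq x n) (seq u n) (seq y n) (seq v n) ε (h′ n (⊔-left l)) (k′ n (⊔-right {M} l))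

  -ʳ-anti : ∀ {x y} → x ≤ʳ y → -ʳ y ≤ʳ -ʳ x
  -ʳ-anti {x} {y} h ε 0<ε = let N , k = h ε 0<ε in
    N , λ n l → neg-step (seq y n) (seq x n) ε (k n l)

≈ʳ-refl : ∀ {x} → x ≈ʳ x
≈ʳ-refl {x} = pointwise-≈ {x} {x} λ _ → refl

ℝ-ℓ-group : ℓ-Group 0ℓ 0ℓ 0ℓ
ℝ-ℓ-group = record
  { Carrier = ℝ ; _≈_ = _≈ʳ_ ; _≤_ = _≤ʳ_
  ; _+_ = _+ʳ_ ; 0# = 0ʳ ; -_ = -ʳ_ ; _∨_ = _⊔ʳ_ ; _∧_ = _⊓ʳ_
  ; isGroup = record
    { isMonoid = record
      { isSemigroup = record
        { isMagma = record
          { isEquivalence = isEquivalence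
          ; ∙-cong = λ {x} {y} {u} {v} h k → ≤ʳ-antisym {x +ʳ u} {y +ʳ v}
              (+ʳ-mono {x} {y} {u} {v} (≈ʳ⇒≤ʳ {x} {y} h) (≈ʳ⇒≤ʳ {u} {v} k))
              (+ʳ-mono {y} {x} {v} {u}
                (≈ʳ⇒≤ʳ {y} {x} (≈ʳ-sym {x} {y} h)) (≈ʳ⇒≤ʳ {v} {u} (≈ʳ-sym {u} {v} k)))
          }
        ; assoc = λ x y z → pointwise-≈ {(x +ʳ y) +ʳ z} {x +ʳ (y +ʳ z)}
            λ n → ℚ.+-assoc (seq x n) (seq y n) (seq z n)
        }
      ; identity =
          (λ x → pointwise-≈ {0ʳ +ʳ x} {x} λ n → ℚ.+-identityˡ (seq x n))
        , (λ x → pointwise-≈ {x +ʳ 0ʳ} {x} λ n → ℚ.+-identityʳ (seq x n))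
      }
    ; inverse =
        (λ x → pointwise-≈ {(-ʳ x) +ʳ x} {0ʳ} λ n → ℚ.+-inverseˡ (seq x n))
      , (λ x → pointwise-≈ {x +ʳ (-ʳ x)} {0ʳ} λ n → ℚ.+-inverseʳ (seq x n))
    ; ⁻¹-cong = λ {x} {y} h → ≤ʳ-antisym { -ʳ x} { -ʳ y}
        (-ʳ-anti {y} {x} (≈ʳ⇒≤ʳ {y} {x} (≈ʳ-sym {x} {y} h))) (-ʳ-anti {x} {y} (≈ʳ⇒≤ʳ {x} {y} h))
    }
  ; isLattice = record
    { isPartialOrder = record
      { isPreorder = record
        { isEquivalence = isEquivalence
        ; reflexive = λ {x} {y} → ≈ʳ⇒≤ʳ {x} {y}
        ; trans = λ {x} {y} {z} → ≤ʳ-trans {x} {y} {z}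
        }
      ; antisym = λ {x} {y} → ≤ʳ-antisym {x} {y}
      }
    ; supremum = λ x y →
        pointwise-≤ {x} {x ⊔ʳ y} (λ n → ℚ.p≤p⊔q (seq x n) (seq y n))
      , pointwise-≤ {y} {x ⊔ʳ y} (λ n → ℚ.p≤q⊔p (seq x n) (seq y n))
      , λ z h k ε 0<ε → let M , h′ = h ε 0<ε ; N , k′ = k ε 0<ε in
          M ℕ.⊔ N , λ n l → ⊔-lub-< (h′ n (⊔-left l)) (k′ n (⊔-right {M} l))
    ; infimum = λ x y →
        pointwise-≤ {x ⊓ʳ y} {x} (λ n → ℚ.p⊓q≤p (seq x n) (seq y n))
      , pointwise-≤ {x ⊓ʳ y} {y} (λ n → ℚ.p⊓q≤q (seq x n) (seq y n))
      , λ z h k ε 0<ε → let M , h′ = h ε 0<ε ; N , k′ = k ε 0<ε in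
          M ℕ.⊔ N , λ n l →
            ⊓-glb-<+ {q = seq x n} {r = seq y n} (h′ n (⊔-left l)) (k′ n (⊔-right {M} l))
    }
  ; +-monoʳ-≤ = λ z {x} {y} → +ʳ-mono {z} {z} {x} {y} (≈ʳ⇒≤ʳ {z} {z} (≈ʳ-refl {z}))
  ; +-monoˡ-≤ = λ z {x} {y} h → +ʳ-mono {x} {y} {z} {z} h (≈ʳ⇒≤ʳ {z} {z} (≈ʳ-refl {z}))
  }
  where
  isEquivalence : IsEquivalence _≈ʳ_
  isEquivalence = record
    { refl  = λ {x} → ≈ʳ-refl {x}
    ; sym   = λ {x} {y} → ≈ʳ-sym {x} {y}
    ; trans = λ {x} {y} {z} → ≈ʳ-trans {x} {y} {z}
    }

-- Subsets are Set₀-valued predicates whatever the level of X; under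
-- excluded middle every predicate is equivalent to one of these.

record σ-Ideal (X : Set a) (ℓ : Level) : Set (a ⊔ suc 0ℓ ⊔ suc ℓ) where
  field
    Null        : Pred (Pred X 0ℓ) ℓ
    ∅-null      : Null ∅
    ⊆-null      : ∀ {S T} → S ⊆ T → Null T → Null S
    ⋃-null      : ∀ (S : ℕ → Pred X 0ℓ) → (∀ n → Null (S n)) → Null (⋃ ℕ S)

-- The quotient is the setoid of functions X → ℝ under equality outside a
-- null set.  Excluded middle enters only the proofs of the laws: from
-- f x ≠ h x it is needed to conclude that f x ≠ g x or g x ≠ h x.

module Quotient (em : ExcludedMiddle 0ℓ) (X : Set a) (I : σ-Ideal X ℓ) where
  open σ-Ideal I

  infix 4 _∼_ _≲_

  _∼_ : Rel (X → ℝ) ℓ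
  f ∼ g = Null λ x → ¬ (f x ≈ʳ g x)

  _≲_ : Rel (X → ℝ) ℓ
  f ≲ g = Null λ x → ¬ (f x ≤ʳ g x)

  private
    module R = ℓ-Group ℝ-ℓ-group
    module RG = IsGroup R.isGroup
    module RL = IsLattice R.isLattice

    null₀ : {C : Pred X 0ℓ} → (∀ x → C x) → Null (λ x → ¬ C x)
    null₀ h = ⊆-null (λ {x} ¬c → ¬c (h x)) ∅-null

    null₁ : {A C : Pred X 0ℓ} → (∀ x → A x → C x) →
            Null (λ x → ¬ A x) → Null (λ x → ¬ C x)
    null₁ h = ⊆-null (λ {x} ¬c a → ¬c (h x a))

    null₂ : {A B C : Pred X 0ℓ} → (∀ x → A x → B x → C x) →
            Null (λ x → ¬ A x) → Null (λ x → ¬ B x) → Null (λ x → ¬ C x)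
    null₂ {A} {B} {C} h nA nB =
      ⊆-null cover (⋃-null family λ { ℕ.zero → nA ; (ℕ.suc _) → nB })
      where
      family : ℕ → Pred X 0ℓ
      family ℕ.zero    x = ¬ A x
      family (ℕ.suc _) x = ¬ B x

      cover : (λ x → ¬ C x) ⊆ ⋃ ℕ family
      cover {x} ¬c with em {A x}
      ... | yes a = 1 , λ b → ¬c (h x a b)
      ... | no ¬a = 0 , ¬a

    isEquivalence : IsEquivalence _∼_
    isEquivalence = record
      { refl  = λ {f} → null₀ λ x → RG.refl {f x}
      ; sym   = λ {f} {g} → null₁ λ x → RG.sym {f x} {g x}
      ; trans = λ {f} {g} {h} → null₂ λ x → RG.trans {f x} {g x} {h x}
      }

  ℓ-group : ℓ-Group a ℓ ℓ
  ℓ-group = record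
    { Carrier = X → ℝ ; _≈_ = _∼_ ; _≤_ = _≲_
    ; _+_ = λ f g x → f x +ʳ g x
    ; 0#  = λ _ → 0ʳ
    ; -_  = λ f x → -ʳ f x
    ; _∨_ = λ f g x → f x ⊔ʳ g x
    ; _∧_ = λ f g x → f x ⊓ʳ g x
    ; isGroup = record
      { isMonoid = record
        { isSemigroup = record
          { isMagma = record
            { isEquivalence = isEquivalence
            ; ∙-cong = λ {f} {g} {h} {k} →
                null₂ λ x → RG.∙-cong {f x} {g x} {h x} {k x}
            }
          ; assoc = λ f g h → null₀ λ x → RG.assoc (f x) (g x) (h x)
          }
        ; identity = (λ f → null₀ λ x → RG.identityˡ (f x))
                   , (λ f → null₀ λ x → RG.identityʳ (f x))
        }
      ; inverse = (λ f → null₀ λ x → RG.inverseˡ (f x))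
                , (λ f → null₀ λ x → RG.inverseʳ (f x))
      ; ⁻¹-cong = λ {f} {g} → null₁ λ x → RG.⁻¹-cong {f x} {g x}
      }
    ; isLattice = record
      { isPartialOrder = record
        { isPreorder = record
          { isEquivalence = isEquivalence
          ; reflexive = λ {f} {g} → null₁ λ x → RL.reflexive {f x} {g x}
          ; trans = λ {f} {g} {h} → null₂ λ x → RL.trans {f x} {g x} {h x}
          }
        ; antisym = λ {f} {g} → null₂ λ x → RL.antisym {f x} {g x}
        }
      ; supremum = λ f g →
          null₀ (λ x → RL.x≤x∨y (f x) (g x))
        , null₀ (λ x → RL.y≤x∨y (f x) (g x))
        , λ h → null₂ λ x → RL.∨-least {f x} {g x} {h x}
      ; infimum = λ f g →
          null₀ (λ x → RL.x∧y≤x (f x) (g x))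
        , null₀ (λ x → RL.x∧y≤y (f x) (g x))
        , λ h → null₂ λ x → RL.∧-greatest {h x} {f x} {g x}
      }
    ; +-monoʳ-≤ = λ h {f} {g} → null₁ λ x → R.+-monoʳ-≤ (h x) {f x} {g x}
    ; +-monoˡ-≤ = λ h {f} {g} → null₁ λ x → R.+-monoˡ-≤ (h x) {f x} {g x}
    }

{-# OPTIONS --safe #-}

-- Take X to be the set of all functions v : G → ℝ, let ι be evaluation, and
-- call a set of such functions null when each of its members violates one of
-- countably many given laws: v u = 1, v (x + y) = v x + v y, and
-- v (⋁ fₙ) = ⋁ v fₙ.  All claims but injectivity are then immediate.
-- For injectivity, given x ≰ 0 and countably many laws, a function v obeying
-- them with v x > 0 is obtained by the Rasiowa–Sikorski method, forcing with
-- elements p > 0 of G: p forces y ≤ z when y ≤ e + z for some e disjoint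
-- from p.  A sufficiently generic decreasing sequence of such p yields a
-- preorder that is total and archimedean on the countably many elements
-- concerned, and Hölder's construction turns it into v.  Commutativity of G
-- is never needed, since it suffices to force x + y ≤ y + x or the reverse.

module Submission where

open import Defs
open import Level using (_⊔_; 0ℓ)
open import Algebra.Bundles using (Group)
open import Algebra.Morphism.Structures using (IsGroupHomomorphism)
import Algebra.Properties.Group as GroupProperties
import Algebra.Properties.Monoid.Mult as Mult
open import Axiom.ExcludedMiddle using (ExcludedMiddle)
open import Data.Integer.Base as ℤ using (ℤ; +_; -[1+_]; +[1+_]; +0; 0ℤ; 1ℤ)
import Data.Integer.Properties as ℤ
open import Data.Integer.Solver using () renaming (module +-*-Solver to ℤ-Solver)
open import Data.Nat.Base as ℕ using (ℕ; zero; suc)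
import Data.Nat.Properties as ℕ
open import Data.Product using (Σ; ∃; _×_; _,_; proj₁; proj₂)
open import Data.Rational.Base as ℚ using (ℚ; mkℚ; 0ℚ; ½; _/_; ∣_∣; toℚᵘ)
import Data.Rational.Properties as ℚ
open import Data.Rational.Solver using () renaming (module +-*-Solver to ℚ-Solver)
open import Data.Rational.Unnormalised.Base as ℚᵘ using (mkℚᵘ; *≡*; *≤*; *<*)
import Data.Rational.Unnormalised.Properties as ℚᵘ
open import Data.Sum using (_⊎_; inj₁; inj₂)
open import Function.Base using (_∘_; flip)
open import Function.Definitions using (Injective; StrictlySurjective)
open import Relation.Binary.Bundles using (Preorder)
open import Relation.Binary.Core using (Rel)
open import Relation.Binary.Definitions using (Reflexive; Transitive)
open import Relation.Binary.Lattice.Structures using (IsLattice)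
open import Relation.Binary.PropositionalEquality as ≡ using (_≡_; cong; subst; subst₂)
import Relation.Binary.Reasoning.Preorder as PreorderReasoning
import Relation.Binary.Reasoning.Setoid as SetoidReasoning
open import Relation.Binary.Structures using (IsPreorder)
open import Relation.Nullary using (¬_; contradiction; yes; no)
open import Relation.Nullary.Decidable using (decidable-stable)
open import Relation.Unary using (Pred; _⊆_; ⋃)

-- Preordered groups

module AdditiveGroup {c ℓ} (𝔾 : Group c ℓ) where
  open Group 𝔾 public
    using (Carrier; _≈_; refl; sym; trans; isEquivalence; setoid; monoid)
    renaming
    ( _∙_ to infixl 6 _+_; ε to 0#; _⁻¹ to infix 8 -_
    ; ∙-cong to +-cong; ∙-congˡ to +-congˡ; ∙-congʳ to +-congʳ
    ; assoc to +-assoc; identityˡ to +-identityˡ; identityʳ to +-identityʳ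
    ; inverseˡ to +-inverseˡ; inverseʳ to +-inverseʳ; ⁻¹-cong to -‿cong )
  open GroupProperties 𝔾 public using () renaming
    ( \\-leftDividesˡ to x+[-x+y]≈y; \\-leftDividesʳ to -x+[x+y]≈y
    ; //-rightDividesˡ to [y-x]+x≈y; //-rightDividesʳ to [y+x]-x≈y
    ; ⁻¹-anti-homo-∙ to -[x+y]≈-y-x; ⁻¹-involutive to -‿involutive
    ; ε⁻¹≈ε to -0≈0 )
  open Mult monoid public using (×-assocˡ; ×-congʳ) renaming (_×_ to _⋆_)
  open SetoidReasoning setoid

  x+n⋆x≈n⋆x+x : ∀ n x → x + n ⋆ x ≈ n ⋆ x + x
  x+n⋆x≈n⋆x+x zero    x = trans (+-identityʳ x) (sym (+-identityˡ x))
  x+n⋆x≈n⋆x+x (suc n) x = trans (+-congˡ (x+n⋆x≈n⋆x+x n x)) (sym (+-assoc x (n ⋆ x) x))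

  conj-⋆ : ∀ n z x → n ⋆ (z + x + - z) ≈ z + n ⋆ x + - z
  conj-⋆ zero    z x = sym (trans (+-congʳ (+-identityʳ z)) (+-inverseʳ z))
  conj-⋆ (suc n) z x = begin
    (z + x + - z) + n ⋆ (z + x + - z)    ≈⟨ +-congˡ (conj-⋆ n z x) ⟩
    (z + x + - z) + (z + n ⋆ x + - z)    ≈⟨ +-congˡ (+-assoc z (n ⋆ x) (- z)) ⟩
    (z + x + - z) + (z + (n ⋆ x + - z))  ≈⟨ +-assoc (z + x) (- z) _ ⟩
    (z + x) + (- z + (z + (n ⋆ x + - z))) ≈⟨ +-congˡ (-x+[x+y]≈y z (n ⋆ x + - z)) ⟩
    (z + x) + (n ⋆ x + - z)              ≈⟨ +-assoc (z + x) (n ⋆ x) (- z) ⟨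
    (z + x + n ⋆ x) + - z                ≈⟨ +-congʳ (+-assoc z x (n ⋆ x)) ⟩
    z + (x + n ⋆ x) + - z                ∎

  -- Integer multiples

  infixr 8 _·_

  _·_ : ℤ → Carrier → Carrier
  (+ n)    · x = n ⋆ x
  -[1+ n ] · x = - (suc n ⋆ x)

  ·-suc : ∀ i x → ℤ.suc i · x ≈ x + i · x
  ·-suc (+ n)        x = refl
  ·-suc -[1+ zero ]  x = sym (trans (+-congˡ (-‿cong (+-identityʳ x))) (+-inverseʳ x))
  ·-suc -[1+ suc n ] x = begin
    - (suc n ⋆ x)                ≈⟨ x+[-x+y]≈y x _ ⟨
    x + (- x + - (suc n ⋆ x))    ≈⟨ +-congˡ (-[x+y]≈-y-x (suc n ⋆ x) x) ⟨
    x + - (suc n ⋆ x + x)        ≈⟨ +-congˡ (-‿cong (x+n⋆x≈n⋆x+x (suc n) x)) ⟨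
    x + - (suc (suc n) ⋆ x)      ∎

  ·-pred : ∀ i x → ℤ.pred i · x ≈ - x + i · x
  ·-pred i x = begin
    ℤ.pred i · x                    ≈⟨ -x+[x+y]≈y x _ ⟨
    - x + (x + ℤ.pred i · x)        ≈⟨ +-congˡ (·-suc (ℤ.pred i) x) ⟨
    - x + ℤ.suc (ℤ.pred i) · x      ≡⟨ cong (λ j → - x + j · x) (ℤ.suc-pred i) ⟩
    - x + i · x                     ∎

  ·-neg : ∀ n x → (ℤ.- (+ n)) · x ≈ - (n ⋆ x)
  ·-neg zero    x = sym -0≈0
  ·-neg (suc n) x = refl

  ·-distribʳ-+ : ∀ i j x → (i ℤ.+ j) · x ≈ i · x + j · x
  ·-distribʳ-+ (+ zero) j x = begin
    (0ℤ ℤ.+ j) · x  ≡⟨ cong (_· x) (ℤ.+-identityˡ j) ⟩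
    j · x           ≈⟨ +-identityˡ (j · x) ⟨
    0# + j · x      ∎
  ·-distribʳ-+ (+ suc n) j x = begin
    (+ suc n ℤ.+ j) · x         ≡⟨ cong (_· x) (ℤ.+-assoc 1ℤ (+ n) j) ⟩
    ℤ.suc (+ n ℤ.+ j) · x       ≈⟨ ·-suc (+ n ℤ.+ j) x ⟩
    x + (+ n ℤ.+ j) · x         ≈⟨ +-congˡ (·-distribʳ-+ (+ n) j x) ⟩
    x + (n ⋆ x + j · x)         ≈⟨ +-assoc x (n ⋆ x) (j · x) ⟨
    suc n ⋆ x + j · x           ∎
  ·-distribʳ-+ -[1+ zero ] j x = begin
    ℤ.pred j · x            ≈⟨ ·-pred j x ⟩
    - x + j · x             ≈⟨ +-congʳ (-‿cong (+-identityʳ x)) ⟨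
    - (x + 0#) + j · x      ∎
  ·-distribʳ-+ -[1+ suc n ] j x = begin
    (-[1+ suc n ] ℤ.+ j) · x        ≡⟨ cong (_· x) (ℤ.+-assoc (ℤ.- 1ℤ) -[1+ n ] j) ⟩
    ℤ.pred (-[1+ n ] ℤ.+ j) · x     ≈⟨ ·-pred (-[1+ n ] ℤ.+ j) x ⟩
    - x + (-[1+ n ] ℤ.+ j) · x      ≈⟨ +-congˡ (·-distribʳ-+ -[1+ n ] j x) ⟩
    - x + (-[1+ n ] · x + j · x)    ≈⟨ +-assoc (- x) (-[1+ n ] · x) (j · x) ⟨
    - x + -[1+ n ] · x + j · x      ≈⟨ +-congʳ (·-pred -[1+ n ] x) ⟨
    -[1+ suc n ] · x + j · x        ∎

  ⋆-·-assoc : ∀ n i x → n ⋆ (i · x) ≈ (+ n ℤ.* i) · x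
  ⋆-·-assoc zero    i x = refl
  ⋆-·-assoc (suc n) i x = begin
    i · x + n ⋆ (i · x)         ≈⟨ +-congˡ (⋆-·-assoc n i x) ⟩
    i · x + (+ n ℤ.* i) · x     ≈⟨ ·-distribʳ-+ i (+ n ℤ.* i) x ⟨
    (i ℤ.+ + n ℤ.* i) · x       ≡⟨ cong (_· x) (ℤ.suc-* (+ n) i) ⟨
    (+ suc n ℤ.* i) · x         ∎

module GroupPreorder {c ℓ} (𝔾 : Group c ℓ) where
  open AdditiveGroup 𝔾

  -- Antisymmetry is left out so that the order of a quotient of the group can be handled as a
  -- preorder on the same carrier.
  record IsGroupPreorder {ℓ′} (_≲_ : Rel Carrier ℓ′) : Set (c ⊔ ℓ ⊔ ℓ′) where
    field
      isPreorder : IsPreorder _≈_ _≲_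
      +-monoʳ    : ∀ z {x y} → x ≲ y → (z + x) ≲ (z + y)
      +-monoˡ    : ∀ z {x y} → x ≲ y → (x + z) ≲ (y + z)

    preorder : Preorder c ℓ ℓ′
    preorder = record { isPreorder = isPreorder }

    open IsPreorder isPreorder public using ()
      renaming (refl to ≲-refl; trans to ≲-trans; reflexive to ≲-reflexive
               ; ≲-respˡ-≈ to ≲-respˡ; ≲-respʳ-≈ to ≲-respʳ)
    open PreorderReasoning preorder

    +-mono : ∀ {x y z w} → x ≲ y → z ≲ w → (x + z) ≲ (y + w)
    +-mono {y = y} {z = z} x≲y z≲w = ≲-trans (+-monoˡ z x≲y) (+-monoʳ y z≲w)

    ⋆-mono : ∀ n {x y} → x ≲ y → (n ⋆ x) ≲ (n ⋆ y)
    ⋆-mono zero    x≲y = ≲-refl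
    ⋆-mono (suc n) x≲y = +-mono x≲y (⋆-mono n x≲y)

    moveˡ : ∀ {x y z} → y ≲ (x + z) → (- x + y) ≲ z
    moveˡ {x} {y} {z} h = ≲-respʳ (-x+[x+y]≈y x z) (+-monoʳ (- x) h)

    moveˡ⁻ : ∀ {x y z} → (- x + y) ≲ z → y ≲ (x + z)
    moveˡ⁻ {x} {y} {z} h = ≲-respˡ (x+[-x+y]≈y x y) (+-monoʳ x h)

    moveʳ : ∀ {x y z} → x ≲ (z + y) → (x + - y) ≲ z
    moveʳ {x} {y} {z} h = ≲-respʳ ([y+x]-x≈y y z) (+-monoˡ (- y) h)

    moveʳ⁻ : ∀ {x y z} → (x + - y) ≲ z → x ≲ (z + y)
    moveʳ⁻ {x} {y} {z} h = ≲-respˡ ([y-x]+x≈y y x) (+-monoˡ y h)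

    +-cancelʳ-≲ : ∀ {x y z} → (x + z) ≲ (y + z) → x ≲ y
    +-cancelʳ-≲ {x} {y} {z} h = ≲-respʳ ([y+x]-x≈y z y) (≲-respˡ ([y+x]-x≈y z x) (+-monoˡ (- z) h))

    -‿anti : ∀ {x y} → x ≲ y → (- y) ≲ (- x)
    -‿anti {x} {y} h = begin
      - y                 ≈⟨ +-identityʳ (- y) ⟨
      - y + 0#            ≈⟨ +-congˡ (+-inverseʳ x) ⟨
      - y + (x + - x)     ≲⟨ moveˡ (+-monoˡ (- x) h) ⟩
      - x                 ∎

    -‿antiˡ : ∀ {x y} → (- x) ≲ y → (- y) ≲ x
    -‿antiˡ {x} h = ≲-respʳ (-‿involutive x) (-‿anti h)

    -‿cancel : ∀ {x y} → (- x) ≲ (- y) → y ≲ x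
    -‿cancel {x} {y} h = ≲-respˡ (-‿involutive y) (-‿antiˡ h)

    x≲0+x : ∀ {x} → x ≲ (0# + x)
    x≲0+x {x} = ≲-reflexive (sym (+-identityˡ x))

    0+x≲x : ∀ {x} → (0# + x) ≲ x
    0+x≲x {x} = ≲-reflexive (+-identityˡ x)

    x≲x+0 : ∀ {x} → x ≲ (x + 0#)
    x≲x+0 {x} = ≲-reflexive (sym (+-identityʳ x))

    x+0≲x : ∀ {x} → (x + 0#) ≲ x
    x+0≲x {x} = ≲-reflexive (+-identityʳ x)

    x≲y+x : ∀ {x y} → 0# ≲ y → x ≲ (y + x)
    x≲y+x {x} 0≲y = ≲-trans x≲0+x (+-monoˡ x 0≲y)

    x≲x+y : ∀ {x y} → 0# ≲ y → x ≲ (x + y)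
    x≲x+y {x} 0≲y = ≲-trans x≲x+0 (+-monoʳ x 0≲y)

    x-y≲0⇒x≲y : ∀ {x y} → (x + - y) ≲ 0# → x ≲ y
    x-y≲0⇒x≲y h = ≲-trans (moveʳ⁻ h) 0+x≲x

    x≲y⇒0≲-x+y : ∀ {x y} → x ≲ y → 0# ≲ (- x + y)
    x≲y⇒0≲-x+y {x} {y} h = ≲-respˡ (+-inverseˡ x) (+-monoʳ (- x) h)

    -x≲0 : ∀ {x} → 0# ≲ x → (- x) ≲ 0#
    -x≲0 0≲x = ≲-respʳ -0≈0 (-‿anti 0≲x)

    0≲n⋆x : ∀ n {x} → 0# ≲ x → 0# ≲ (n ⋆ x)
    0≲n⋆x zero    0≲x = ≲-refl
    0≲n⋆x (suc n) 0≲x = ≲-trans (0≲n⋆x n 0≲x) (x≲y+x 0≲x)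

    ·-monoˡ : ∀ {x i j} → 0# ≲ x → i ℤ.≤ j → (i · x) ≲ (j · x)
    ·-monoˡ {x} {i} {j} 0≲x i≤j with j ℤ.- i in eq | ℤ.i≤j⇒0≤j-i i≤j
    ... | + n | _ = begin
      i · x                     ≲⟨ x≲x+y (0≲n⋆x n 0≲x) ⟩
      i · x + n ⋆ x             ≈⟨ ·-distribʳ-+ i (+ n) x ⟨
      (i ℤ.+ + n) · x           ≈⟨ cong-· (≡.trans (cong (λ k → i ℤ.+ k) (≡.sym eq)) i+[j-i]≡j) ⟩
      j · x                     ∎
      where
      cong-· : ∀ {k l} → k ≡ l → k · x ≈ l · x
      cong-· ≡.refl = refl
      i+[j-i]≡j : i ℤ.+ (j ℤ.- i) ≡ j
      i+[j-i]≡j = ℤ-Solver.solve 2 (λ i j → i :+ (j :- i) := j) ≡.refl i j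
        where open ℤ-Solver

    module _ {x y} (x+y≲y+x : (x + y) ≲ (y + x)) where

      n⋆x+y≲y+n⋆x : ∀ n → (n ⋆ x + y) ≲ (y + n ⋆ x)
      n⋆x+y≲y+n⋆x zero    = ≲-trans 0+x≲x x≲x+0
      n⋆x+y≲y+n⋆x (suc n) = begin
        x + n ⋆ x + y       ≈⟨ +-assoc x (n ⋆ x) y ⟩
        x + (n ⋆ x + y)     ≲⟨ +-monoʳ x (n⋆x+y≲y+n⋆x n) ⟩
        x + (y + n ⋆ x)     ≈⟨ +-assoc x y (n ⋆ x) ⟨
        x + y + n ⋆ x       ≲⟨ +-monoˡ (n ⋆ x) x+y≲y+x ⟩
        y + x + n ⋆ x       ≈⟨ +-assoc y x (n ⋆ x) ⟩
        y + (x + n ⋆ x)     ∎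

      x+n⋆y≲n⋆y+x : ∀ n → (x + n ⋆ y) ≲ (n ⋆ y + x)
      x+n⋆y≲n⋆y+x zero    = ≲-trans x+0≲x x≲0+x
      x+n⋆y≲n⋆y+x (suc n) = begin
        x + (y + n ⋆ y)     ≈⟨ +-assoc x y (n ⋆ y) ⟨
        x + y + n ⋆ y       ≲⟨ +-monoˡ (n ⋆ y) x+y≲y+x ⟩
        y + x + n ⋆ y       ≈⟨ +-assoc y x (n ⋆ y) ⟩
        y + (x + n ⋆ y)     ≲⟨ +-monoʳ y (x+n⋆y≲n⋆y+x n) ⟩
        y + (n ⋆ y + x)     ≈⟨ +-assoc y (n ⋆ y) x ⟨
        y + n ⋆ y + x       ∎

      -- Under the assumption of the module, moving a `y` to the left past an `x` raises a sum.
      -- Among the sums of `n` copies of each, the one with every `x` first is therefore least and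
      -- the one with every `y` first is greatest; this lemma and the next place `n ⋆ (x + y)`
      -- between them.
      n⋆x+n⋆y≲n⋆[x+y] : ∀ n → (n ⋆ x + n ⋆ y) ≲ (n ⋆ (x + y))
      n⋆x+n⋆y≲n⋆[x+y] zero    = 0+x≲x
      n⋆x+n⋆y≲n⋆[x+y] (suc n) = begin
        (x + n ⋆ x) + (y + n ⋆ y)     ≈⟨ +-assoc x (n ⋆ x) (y + n ⋆ y) ⟩
        x + (n ⋆ x + (y + n ⋆ y))     ≈⟨ +-congˡ (+-assoc (n ⋆ x) y (n ⋆ y)) ⟨
        x + (n ⋆ x + y + n ⋆ y)       ≲⟨ +-monoʳ x (+-monoˡ (n ⋆ y) (n⋆x+y≲y+n⋆x n)) ⟩
        x + (y + n ⋆ x + n ⋆ y)       ≈⟨ +-congˡ (+-assoc y (n ⋆ x) (n ⋆ y)) ⟩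
        x + (y + (n ⋆ x + n ⋆ y))     ≈⟨ +-assoc x y _ ⟨
        x + y + (n ⋆ x + n ⋆ y)       ≲⟨ +-monoʳ (x + y) (n⋆x+n⋆y≲n⋆[x+y] n) ⟩
        x + y + n ⋆ (x + y)           ∎

      n⋆[x+y]≲n⋆y+n⋆x : ∀ n → (n ⋆ (x + y)) ≲ (n ⋆ y + n ⋆ x)
      n⋆[x+y]≲n⋆y+n⋆x zero    = x≲0+x
      n⋆[x+y]≲n⋆y+n⋆x (suc n) = begin
        x + y + n ⋆ (x + y)           ≲⟨ +-mono x+y≲y+x (n⋆[x+y]≲n⋆y+n⋆x n) ⟩
        y + x + (n ⋆ y + n ⋆ x)       ≈⟨ +-assoc y x _ ⟩
        y + (x + (n ⋆ y + n ⋆ x))     ≈⟨ +-congˡ (+-assoc x (n ⋆ y) (n ⋆ x)) ⟨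
        y + (x + n ⋆ y + n ⋆ x)       ≲⟨ +-monoʳ y (+-monoˡ (n ⋆ x) (x+n⋆y≲n⋆y+x n)) ⟩
        y + (n ⋆ y + x + n ⋆ x)       ≈⟨ +-congˡ (+-assoc (n ⋆ y) x (n ⋆ x)) ⟩
        y + (n ⋆ y + (x + n ⋆ x))     ≈⟨ +-assoc y (n ⋆ y) _ ⟨
        y + n ⋆ y + (x + n ⋆ x)       ∎

  -- Reversing the order turns the opposite hypothesis `y + x ≲ x + y` into the one assumed above,
  -- so that the lemmas on multiples of a sum cover both cases.
  flip-isGroupPreorder : ∀ {ℓ′} {_≲_ : Rel Carrier ℓ′} →
                         IsGroupPreorder _≲_ → IsGroupPreorder (flip _≲_)
  flip-isGroupPreorder O = record
    { isPreorder = record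
      { isEquivalence = isEquivalence
      ; reflexive = λ x≈y → ≲-reflexive (sym x≈y)
      ; trans = λ y≲x z≲y → ≲-trans z≲y y≲x
      }
    ; +-monoʳ = λ z → +-monoʳ z
    ; +-monoˡ = λ z → +-monoˡ z
    }
    where open IsGroupPreorder O

-- Rational and real estimates

/-mono-≤ : ∀ a b {m n} → a ℤ.* + suc n ℤ.≤ b ℤ.* + suc m → a / suc m ℚ.≤ b / suc n
/-mono-≤ a b {m} {n} h = ℚ.toℚᵘ-cancel-≤
  (ℚᵘ.≤-respˡ-≃ (ℚᵘ.≃-sym (ℚ.toℚᵘ-fromℚᵘ (mkℚᵘ a m)))
    (ℚᵘ.≤-respʳ-≃ (ℚᵘ.≃-sym (ℚ.toℚᵘ-fromℚᵘ (mkℚᵘ b n))) (*≤* h)))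

+-/ : ∀ a b n → (a ℤ.+ b) / suc n ≡ a / suc n ℚ.+ b / suc n
+-/ a b n = ℚ.toℚᵘ-injective (begin
  toℚᵘ ((a ℤ.+ b) / suc n)                 ≈⟨ ℚ.toℚᵘ-fromℚᵘ (mkℚᵘ (a ℤ.+ b) n) ⟩
  mkℚᵘ (a ℤ.+ b) n                         ≈⟨ *≡* eq ⟩
  mkℚᵘ a n ℚᵘ.+ mkℚᵘ b n                   ≈⟨ ℚᵘ.+-cong (ℚ.toℚᵘ-fromℚᵘ (mkℚᵘ a n))
                                                        (ℚ.toℚᵘ-fromℚᵘ (mkℚᵘ b n)) ⟨
  toℚᵘ (a / suc n) ℚᵘ.+ toℚᵘ (b / suc n)   ≈⟨ ℚ.toℚᵘ-homo-+ (a / suc n) (b / suc n) ⟨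
  toℚᵘ (a / suc n ℚ.+ b / suc n)           ∎)
  where
  open import Relation.Binary.Reasoning.Setoid ℚᵘ.≃-setoid
  eq : (a ℤ.+ b) ℤ.* (+ suc n ℤ.* + suc n) ≡ (a ℤ.* + suc n ℤ.+ b ℤ.* + suc n) ℤ.* + suc n
  eq = solve 3 (λ a b d → (a :+ b) :* (d :* d) := (a :* d :+ b :* d) :* d) ≡.refl a b (+ suc n)
    where open ℤ-Solver

suc-/ : ∀ a n → ℤ.suc a / suc n ≡ a / suc n ℚ.+ 1ℤ / suc n
suc-/ a n = ≡.trans (cong (_/ suc n) (ℤ.+-comm 1ℤ a)) (+-/ a 1ℤ n)

1/n→0 : ∀ {ε} → 0ℚ ℚ.< ε → ∃ λ N → ∀ n → N ℕ.≤ n → 1ℤ / suc n ℚ.< ε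
1/n→0 {mkℚ +0 _ _} (ℚ.*<* (ℤ.+<+ ()))
1/n→0 {mkℚ -[1+ _ ] _ _} (ℚ.*<* ())
-- Here ε = (k + 1)/(d + 1), and n ≥ d + 1 gives 1/(n + 1) ≤ 1/(d + 2) < ε.
1/n→0 {ε@(mkℚ +[1+ k ] d _)} _ = suc d , λ n N≤n →
  ℚ.≤-<-trans
    (/-mono-≤ 1ℤ 1ℤ (ℤ.*-monoˡ-≤-nonNeg 1ℤ (ℤ.+≤+ (ℕ.s≤s N≤n))))
    (ℚ.toℚᵘ-cancel-< (ℚᵘ.<-respˡ-≃ (ℚᵘ.≃-sym (ℚ.toℚᵘ-fromℚᵘ (mkℚᵘ 1ℤ (suc d)))) (*<* (ℤ.+<+ d+1<))))
  where
  d+1< : 1 ℕ.* suc d ℕ.< suc k ℕ.* suc (suc d)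
  d+1< = ℕ.<-≤-trans (ℕ.≤-reflexive (cong suc (ℕ.*-identityˡ (suc d))))
    (ℕ.m≤m+n (suc (suc d)) (k ℕ.* suc (suc d)))

private
  module ℝ′ = ℓ-Group ℝ-ℓ-group

½+½ : ∀ ε → ½ ℚ.* ε ℚ.+ ½ ℚ.* ε ≡ ε
½+½ ε = ≡.trans (≡.sym (ℚ.*-distribʳ-+ ε ½ ½)) (ℚ.*-identityˡ ε)

0<½* : ∀ {ε} → 0ℚ ℚ.< ε → 0ℚ ℚ.< ½ ℚ.* ε
0<½* {ε} h = subst (ℚ._< ½ ℚ.* ε) (ℚ.*-zeroʳ ½) (ℚ.*-monoʳ-<-pos ½ h)

∣p-q∣< : ∀ p q {ε} → p ℚ.< q ℚ.+ ε → q ℚ.< p ℚ.+ ε → ∣ p ℚ.- q ∣ ℚ.< ε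
∣p-q∣< p q {ε} p< q< with ℚ.∣p∣≡p∨∣p∣≡-p (p ℚ.- q)
... | inj₁ eq = subst (ℚ._< ε) (≡.sym eq)
  (subst (p ℚ.- q ℚ.<_) (solve 2 (λ q e → (q :+ e) :- q := e) ≡.refl q ε) (ℚ.+-monoˡ-< (ℚ.- q) p<))
  where open ℚ-Solver
... | inj₂ eq = subst (ℚ._< ε)
  (≡.trans (solve 2 (λ p q → q :- p := :- (p :- q)) ≡.refl p q) (≡.sym eq))
  (subst (q ℚ.- p ℚ.<_) (solve 2 (λ p e → (p :+ e) :- p := e) ≡.refl p ε) (ℚ.+-monoˡ-< (ℚ.- p) q<))
  where open ℚ-Solver

p<p+ε : ∀ p {ε} → 0ℚ ℚ.< ε → p ℚ.< p ℚ.+ ε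
p<p+ε p {ε} h = subst (ℚ._< p ℚ.+ ε) (ℚ.+-identityʳ p) (ℚ.+-monoʳ-< p h)

≤ʳ-pointwise : ∀ {x y} → (∀ n → seq x n ℚ.≤ seq y n) → x ≤ʳ y
≤ʳ-pointwise {y = y} h ε 0<ε = 0 , λ n _ → ℚ.≤-<-trans (h n) (p<p+ε (seq y n) 0<ε)

-- The double error absorbs the two approximation errors in a sum.
squeeze : ∀ {y z} → (∀ n → y ≤ʳ z +ʳ (fromℚ (1ℤ / suc n) +ʳ fromℚ (1ℤ / suc n))) → y ≤ʳ z
squeeze {y} {z} h ε 0<ε with 1/n→0 (0<½* (0<½* 0<ε))
... | n , small with h n (½ ℚ.* ε) (0<½* 0<ε)
... | N , y<z+ = N , λ m N≤m → ℚ.<-≤-trans (y<z+ m N≤m) (begin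
  seq z m ℚ.+ (δ ℚ.+ δ) ℚ.+ ε/2           ≤⟨ ℚ.+-monoˡ-≤ ε/2 (ℚ.+-monoʳ-≤ (seq z m) (ℚ.+-mono-≤ δ≤ δ≤)) ⟩
  seq z m ℚ.+ (ε/4 ℚ.+ ε/4) ℚ.+ ε/2       ≡⟨ cong (λ t → seq z m ℚ.+ t ℚ.+ ε/2) (½+½ ε/2) ⟩
  seq z m ℚ.+ ε/2 ℚ.+ ε/2                 ≡⟨ ℚ.+-assoc (seq z m) ε/2 ε/2 ⟩
  seq z m ℚ.+ (ε/2 ℚ.+ ε/2)               ≡⟨ cong (seq z m ℚ.+_) (½+½ ε) ⟩
  seq z m ℚ.+ ε                           ∎)
  where
  open ℚ.≤-Reasoning
  δ ε/2 ε/4 : ℚ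
  δ = 1ℤ / suc n
  ε/2 = ½ ℚ.* ε
  ε/4 = ½ ℚ.* ε/2
  δ≤ : δ ℚ.≤ ε/4
  δ≤ = ℚ.<⇒≤ (small n ℕ.≤-refl)

+ʳ-mono : ∀ {x y z w} → x ≤ʳ y → z ≤ʳ w → x +ʳ z ≤ʳ y +ʳ w
+ʳ-mono {x} {y} {z} {w} x≤y z≤w = ≤ʳ-trans {x +ʳ z} {y +ʳ z} {y +ʳ w}
  (ℝ′.+-monoˡ-≤ z {x} {y} x≤y) (ℝ′.+-monoʳ-≤ y {z} {w} z≤w)

0<1/n : ∀ n → 0ℚ ℚ.< 1ℤ / suc n
0<1/n n = ℚ.positive⁻¹ (1ℤ / suc n) {{ℚ.normalize-pos 1 (suc n)}}

1/n≰0 : ∀ n → ¬ (fromℚ (1ℤ / suc n) ≤ʳ 0ʳ)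
1/n≰0 n h = let N , 1/n< = h (1ℤ / suc n) (0<1/n n) in
  ℚ.<-irrefl (≡.sym (ℚ.+-identityˡ (1ℤ / suc n))) (1/n< N ℕ.≤-refl)

-- Brings a single error 1/(n + 1) into the form that `squeeze` takes.
≤ʳ-weaken : ∀ {x y} n → x ≤ʳ y +ʳ fromℚ (1ℤ / suc n) →
            x ≤ʳ y +ʳ (fromℚ (1ℤ / suc n) +ʳ fromℚ (1ℤ / suc n))
≤ʳ-weaken {x} {y} n h = ≤ʳ-trans {x} {y +ʳ δ} {y +ʳ (δ +ʳ δ)} h
  (ℝ′.+-monoʳ-≤ y {δ} {δ +ʳ δ} (≤ʳ-pointwise {δ} {δ +ʳ δ} λ _ →
    ℚ.<⇒≤ (p<p+ε (1ℤ / suc n) (0<1/n n))))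
  where
  δ : ℝ
  δ = fromℚ (1ℤ / suc n)

-- Hölder's theorem, restricted to the elements on which the preorder is
-- sufficiently decided.
module Hölder {c ℓ ℓ′} (𝔾 : Group c ℓ) (em : ExcludedMiddle ℓ′)
  {_≲_ : Rel (Group.Carrier 𝔾) ℓ′} (≲-isGroupPreorder : GroupPreorder.IsGroupPreorder 𝔾 _≲_)
  (u : Group.Carrier 𝔾) (0≲u : Group.ε 𝔾 ≲ u) (u≴0 : ¬ (u ≲ Group.ε 𝔾)) where

  open AdditiveGroup 𝔾
  open GroupPreorder 𝔾
  open IsGroupPreorder ≲-isGroupPreorder
  open PreorderReasoning preorder

  -- For every denominator n + 1, the ratio of `x` to `u` lies between consecutive fractions a/(n +
  -- 1) and (a + 1)/(n + 1). This is the part of totality and archimedeanness from which the value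
  -- of `x` is built.
  Located : Carrier → Set ℓ′
  Located x = ∀ n → ∃ λ a → ((a · u) ≲ (suc n ⋆ x)) × ((suc n ⋆ x) ≲ (ℤ.suc a · u))

  -- If j < i, then u + j · u ≲ i · u ≲ j · u, and cancelling j · u contradicts `u≴0`.
  ·u-cancel-≤ : ∀ i j → (i · u) ≲ (j · u) → i ℤ.≤ j
  ·u-cancel-≤ i j i≲j = ℤ.≮⇒≥ λ j<i → u≴0 (+-cancelʳ-≲ (begin
    u + j · u       ≈⟨ ·-suc j u ⟨
    ℤ.suc j · u     ≲⟨ ·-monoˡ 0≲u (ℤ.i<j⇒suc[i]≤j j<i) ⟩
    i · u           ≲⟨ i≲j ⟩
    j · u           ≲⟨ x≲0+x ⟩
    0# + j · u      ∎))

  bounds-≤ : ∀ {x} a m b n → (a · u) ≲ (suc m ⋆ x) → (suc n ⋆ x) ≲ (b · u) → a / suc m ℚ.≤ b / suc n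
  bounds-≤ {x} a m b n lower upper = /-mono-≤ a b
    (subst₂ ℤ._≤_ (ℤ.*-comm (+ suc n) a) (ℤ.*-comm (+ suc m) b)
    (·u-cancel-≤ (+ suc n ℤ.* a) (+ suc m ℤ.* b) (begin
      (+ suc n ℤ.* a) · u           ≈⟨ ⋆-·-assoc (suc n) a u ⟨
      suc n ⋆ a · u                 ≲⟨ ⋆-mono (suc n) lower ⟩
      suc n ⋆ (suc m ⋆ x)           ≈⟨ ×-assocˡ x (suc n) (suc m) ⟩
      (suc n ℕ.* suc m) ⋆ x         ≡⟨ cong (_⋆ x) (ℕ.*-comm (suc n) (suc m)) ⟩
      (suc m ℕ.* suc n) ⋆ x         ≈⟨ ×-assocˡ x (suc m) (suc n) ⟨
      suc m ⋆ (suc n ⋆ x)           ≲⟨ ⋆-mono (suc m) upper ⟩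
      suc m ⋆ b · u                 ≈⟨ ⋆-·-assoc (suc m) b u ⟩
      (+ suc m ℤ.* b) · u           ∎)))

  approx : ∀ {x} → Located x → ℕ → ℚ
  approx L n = proj₁ (L n) / suc n

  -- The right side equals (b + 1)/(n + 1), the upper end of the bracket at stage `n`, which no
  -- lower bound exceeds. Applied to the lower ends `approx L m`, this makes the approximations
  -- Cauchy.
  lower-≤-approx : ∀ {x} (L : Located x) a m → (a · u) ≲ (suc m ⋆ x) →
                   ∀ n → a / suc m ℚ.≤ approx L n ℚ.+ 1ℤ / suc n
  lower-≤-approx L a m lower n with L n
  ... | b , _ , upper = ℚ.≤-trans (bounds-≤ a m (ℤ.suc b) n lower upper) (ℚ.≤-reflexive (suc-/ b n))

  value : ∀ {x} → Located x → ℝ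
  value L = mkℝ (approx L) λ ε 0<ε → let N , small = 1/n→0 0<ε in
    N , λ m n N≤m N≤n → ∣p-q∣< (approx L m) (approx L n) (close small m n N≤n) (close small n m N≤m)
    where
    close : ∀ {ε N} → (∀ n → N ℕ.≤ n → 1ℤ / suc n ℚ.< ε) →
            ∀ m n → N ℕ.≤ n → approx L m ℚ.< approx L n ℚ.+ ε
    close small m n N≤n = ℚ.≤-<-trans (lower-≤-approx L (proj₁ (L m)) m (proj₁ (proj₂ (L m))) n)
      (ℚ.+-monoʳ-< (approx L n) (small n N≤n))

  -- A point of the representation is a function on the whole group, hence the default value 0 at
  -- elements that are not located.
  eval : Carrier → ℝ
  eval x with em {Located x}
  ... | yes L = value L
  ... | no  _ = 0ʳ

  lower⇒≤eval : ∀ {x} → Located x → ∀ a m → (a · u) ≲ (suc m ⋆ x) → fromℚ (a / suc m) ≤ʳ eval x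
  lower⇒≤eval {x} L a m lower with em {Located x}
  ... | no ¬L = contradiction L ¬L
  -- The proof `L′` returned by excluded middle may choose other brackets than `L`; the bound holds
  -- for any choice.
  ... | yes L′ = λ ε 0<ε → let N , small = 1/n→0 0<ε in
    N , λ n N≤n → ℚ.≤-<-trans (lower-≤-approx L′ a m lower n)
      (ℚ.+-monoʳ-< (approx L′ n) (small n N≤n))

  upper⇒eval≤ : ∀ {x} → Located x → ∀ b m → (suc m ⋆ x) ≲ (b · u) → eval x ≤ʳ fromℚ (b / suc m)
  upper⇒eval≤ {x} L b m upper with em {Located x}
  ... | no ¬L = contradiction L ¬L
  ... | yes L′ = ≤ʳ-pointwise {value L′} {fromℚ (b / suc m)} λ n →
    bounds-≤ (proj₁ (L′ n)) n b m (proj₁ (proj₂ (L′ n))) upper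

  private
    ≤-suc-/ : ∀ {x y a n} → x ≤ʳ fromℚ (ℤ.suc a / suc n) → fromℚ (a / suc n) ≤ʳ y →
              x ≤ʳ y +ʳ fromℚ (1ℤ / suc n)
    ≤-suc-/ {x} {y} {a} {n} x≤ ≤y = ≤ʳ-trans {x} {fromℚ (ℤ.suc a / suc n)} {y +ʳ δ} x≤
      (≤ʳ-trans {fromℚ (ℤ.suc a / suc n)} {fromℚ (a / suc n) +ʳ δ} {y +ʳ δ}
        (≤ʳ-pointwise {fromℚ (ℤ.suc a / suc n)} {fromℚ (a / suc n) +ʳ δ} λ _ →
          ℚ.≤-reflexive (suc-/ a n))
        (ℝ′.+-monoˡ-≤ δ {fromℚ (a / suc n)} {y} ≤y))
      where
      δ : ℝ
      δ = fromℚ (1ℤ / suc n)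

  eval-mono : ∀ {x y} → Located x → Located y → x ≲ y → eval x ≤ʳ eval y
  eval-mono {x} {y} Lx Ly x≲y = squeeze {eval x} {eval y} λ n → let a , lower , upper = Lx n in
    ≤ʳ-weaken {eval x} {eval y} n (≤-suc-/ {eval x} {eval y} {a} {n}
      (upper⇒eval≤ Lx (ℤ.suc a) n upper)
      (lower⇒≤eval Ly a n (≲-trans lower (⋆-mono (suc n) x≲y))))

  -- `n ⋆ (x + y)` lies between `n ⋆ x + n ⋆ y` and `n ⋆ y + n ⋆ x`, in the order decided by `c`.
  -- The bounds are multiples of `u`, which commute, so both cases lead to the same interval.
  ⋆-sum-bounds : ∀ {x y} → (x + y) ≲ (y + x) ⊎ (y + x) ≲ (x + y) →
                 ∀ n {a a′ b b′} →
                 (a · u) ≲ (n ⋆ x) → (n ⋆ x) ≲ (a′ · u) → (b · u) ≲ (n ⋆ y) → (n ⋆ y) ≲ (b′ · u) →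
                 (((a ℤ.+ b) · u) ≲ (n ⋆ (x + y))) × ((n ⋆ (x + y)) ≲ ((a′ ℤ.+ b′) · u))
  ⋆-sum-bounds {x} {y} c n {a} {a′} {b} {b′} a≲ ≲a′ b≲ ≲b′ = lower c , upper c
    where
    module Flip = IsGroupPreorder (flip-isGroupPreorder ≲-isGroupPreorder)

    ·-comm : ∀ i j → i · u + j · u ≈ (j ℤ.+ i) · u
    ·-comm i j = trans (sym (·-distribʳ-+ i j u))
      (subst (λ k → k · u ≈ (j ℤ.+ i) · u) (ℤ.+-comm j i) refl)

    lower : _ → ((a ℤ.+ b) · u) ≲ (n ⋆ (x + y))
    lower (inj₁ xy≲yx) = begin
      (a ℤ.+ b) · u         ≈⟨ ·-distribʳ-+ a b u ⟩
      a · u + b · u         ≲⟨ +-mono a≲ b≲ ⟩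
      n ⋆ x + n ⋆ y         ≲⟨ n⋆x+n⋆y≲n⋆[x+y] xy≲yx n ⟩
      n ⋆ (x + y)           ∎
    lower (inj₂ yx≲xy) = begin
      (a ℤ.+ b) · u         ≈⟨ ·-comm b a ⟨
      b · u + a · u         ≲⟨ +-mono b≲ a≲ ⟩
      n ⋆ y + n ⋆ x         ≲⟨ Flip.n⋆[x+y]≲n⋆y+n⋆x yx≲xy n ⟩
      n ⋆ (x + y)           ∎

    upper : _ → (n ⋆ (x + y)) ≲ ((a′ ℤ.+ b′) · u)
    upper (inj₁ xy≲yx) = begin
      n ⋆ (x + y)           ≲⟨ n⋆[x+y]≲n⋆y+n⋆x xy≲yx n ⟩
      n ⋆ y + n ⋆ x         ≲⟨ +-mono ≲b′ ≲a′ ⟩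
      b′ · u + a′ · u       ≈⟨ ·-comm b′ a′ ⟩
      (a′ ℤ.+ b′) · u       ∎
    upper (inj₂ yx≲xy) = begin
      n ⋆ (x + y)           ≲⟨ Flip.n⋆x+n⋆y≲n⋆[x+y] yx≲xy n ⟩
      n ⋆ x + n ⋆ y         ≲⟨ +-mono ≲a′ ≲b′ ⟩
      a′ · u + b′ · u       ≈⟨ ·-distribʳ-+ a′ b′ u ⟨
      (a′ ℤ.+ b′) · u       ∎

  -- Brackets of width 1/(n + 1) for `x` and `y` add up to one of width 2/(n + 1) that contains both
  -- sides; this is the slack that `squeeze` allows.
  eval-+ : ∀ {x y} → Located x → Located y → Located (x + y) →
           (x + y) ≲ (y + x) ⊎ (y + x) ≲ (x + y) → eval (x + y) ≈ʳ eval x +ʳ eval y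
  eval-+ {x} {y} Lx Ly Lxy c = ≤ʳ-antisym {X+Y} {X +ʳ Y}
    (squeeze {X+Y} {X +ʳ Y} λ n →
      let a , a≲ , ≲a = Lx n ; b , b≲ , ≲b = Ly n
          lower , upper = ⋆-sum-bounds c (suc n) {a} {ℤ.suc a} {b} {ℤ.suc b} a≲ ≲a b≲ ≲b
          δ = fromℚ (1ℤ / suc n)
          p = fromℚ (ℤ.suc a / suc n) ; q = fromℚ (ℤ.suc b / suc n)
          p≤ = ≤-suc-/ {p} {X} {a} {n} (≈ʳ⇒≤ʳ {p} {p} (≈ʳ-refl {p})) (lower⇒≤eval Lx a n a≲)
          q≤ = ≤-suc-/ {q} {Y} {b} {n} (≈ʳ⇒≤ʳ {q} {q} (≈ʳ-refl {q})) (lower⇒≤eval Ly b n b≲)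
      in ≤ʳ-trans {X+Y} {p +ʳ q} {X +ʳ Y +ʳ (δ +ʳ δ)}
           (≤ʳ-trans {X+Y} {fromℚ ((ℤ.suc a ℤ.+ ℤ.suc b) / suc n)} {p +ʳ q}
             (upper⇒eval≤ Lxy (ℤ.suc a ℤ.+ ℤ.suc b) n upper)
             (≤ʳ-pointwise {fromℚ ((ℤ.suc a ℤ.+ ℤ.suc b) / suc n)} {p +ʳ q} λ _ →
               ℚ.≤-reflexive (+-/ (ℤ.suc a) (ℤ.suc b) n)))
           (≤ʳ-trans {p +ʳ q} {(X +ʳ δ) +ʳ (Y +ʳ δ)} {X +ʳ Y +ʳ (δ +ʳ δ)}
             (+ʳ-mono {p} {X +ʳ δ} {q} {Y +ʳ δ} p≤ q≤)
             (regroup X Y δ)))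
    (squeeze {X +ʳ Y} {X+Y} λ n →
      let a , a≲ , ≲a = Lx n ; b , b≲ , ≲b = Ly n
          lower , upper = ⋆-sum-bounds c (suc n) {a} {ℤ.suc a} {b} {ℤ.suc b} a≲ ≲a b≲ ≲b
          δ = fromℚ (1ℤ / suc n)
          p = fromℚ (a / suc n) ; q = fromℚ (b / suc n)
          X≤ = ≤-suc-/ {X} {p} {a} {n} (upper⇒eval≤ Lx (ℤ.suc a) n ≲a) (≈ʳ⇒≤ʳ {p} {p} (≈ʳ-refl {p}))
          Y≤ = ≤-suc-/ {Y} {q} {b} {n} (upper⇒eval≤ Ly (ℤ.suc b) n ≲b) (≈ʳ⇒≤ʳ {q} {q} (≈ʳ-refl {q}))
      in ≤ʳ-trans {X +ʳ Y} {(p +ʳ δ) +ʳ (q +ʳ δ)} {X+Y +ʳ (δ +ʳ δ)}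
           (+ʳ-mono {X} {p +ʳ δ} {Y} {q +ʳ δ} X≤ Y≤)
           (≤ʳ-trans {(p +ʳ δ) +ʳ (q +ʳ δ)} {p +ʳ q +ʳ (δ +ʳ δ)} {X+Y +ʳ (δ +ʳ δ)}
             (regroup p q δ)
             (ℝ′.+-monoˡ-≤ (δ +ʳ δ) {p +ʳ q} {X+Y}
               (≤ʳ-trans {p +ʳ q} {fromℚ ((a ℤ.+ b) / suc n)} {X+Y}
                 (≤ʳ-pointwise {p +ʳ q} {fromℚ ((a ℤ.+ b) / suc n)} λ _ →
                   ℚ.≤-reflexive (≡.sym (+-/ a b n)))
                 (lower⇒≤eval Lxy (a ℤ.+ b) n lower)))))
    where
    X Y X+Y : ℝ
    X = eval x
    Y = eval y
    X+Y = eval (x + y)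

    regroup : ∀ v w t → (v +ʳ t) +ʳ (w +ʳ t) ≤ʳ v +ʳ w +ʳ (t +ʳ t)
    regroup v w t = ≤ʳ-pointwise {(v +ʳ t) +ʳ (w +ʳ t)} {v +ʳ w +ʳ (t +ʳ t)} λ n → ℚ.≤-reflexive
      (solve 3 (λ v w t → (v :+ t) :+ (w :+ t) := v :+ w :+ (t :+ t)) ≡.refl
        (seq v n) (seq w n) (seq t n))
      where open ℚ-Solver

  eval-u : Located u → eval u ≈ʳ 1ʳ
  eval-u L = ≤ʳ-antisym {eval u} {1ʳ} (upper⇒eval≤ L 1ℤ 0 ≲-refl) (lower⇒≤eval L 1ℤ 0 ≲-refl)

-- Forcing with positive elements

module ℓ-GroupOrder {c ℓ₁ ℓ₂} (G : ℓ-Group c ℓ₁ ℓ₂) where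
  open ℓ-Group G public using (_≤_; _∨_; _∧_; poset)
  open IsLattice (ℓ-Group.isLattice G) public
    using (isPreorder; antisym; x≤x∨y; y≤x∨y; ∨-least; x∧y≤x; x∧y≤y; ∧-greatest)

  group : Group c ℓ₁
  group = record { isGroup = ℓ-Group.isGroup G }

  open AdditiveGroup group public
  open GroupPreorder group public

  ≤-isGroupPreorder : IsGroupPreorder _≤_
  ≤-isGroupPreorder = record
    { isPreorder = isPreorder
    ; +-monoʳ = ℓ-Group.+-monoʳ-≤ G
    ; +-monoˡ = ℓ-Group.+-monoˡ-≤ G
    }

-- Disjointness and the preorders modulo polars

module Archimedean {c ℓ₁ ℓ₂} (G : ℓ-Group c ℓ₁ ℓ₂)
  (complete : DedekindσComplete (ℓ-Group.poset G)) where
  open ℓ-GroupOrder G public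
  open IsGroupPreorder ≤-isGroupPreorder public
    renaming (≲-refl to ≤-refl; ≲-trans to ≤-trans; ≲-reflexive to ≤-reflexive)
  open PreorderReasoning preorder

  -- Every `f n` is at most `s + - x`, so leastness gives `s ≤ s + - x`.
  sup-translate : ∀ {f s x} → IsSupremum poset f s → (∀ n → f n + x ≤ s) → x ≤ 0#
  sup-translate {f} {s} {x} (_ , least) h = begin
    x                   ≈⟨ -x+[x+y]≈y s x ⟨
    - s + (s + x)       ≲⟨ +-monoʳ (- s) (+-monoˡ x (least (s + - x) λ n →
                             ≲-respˡ ([y+x]-x≈y x (f n)) (+-monoˡ (- x) (h n)))) ⟩
    - s + (s + - x + x) ≈⟨ +-congˡ ([y-x]+x≈y x s) ⟩
    - s + s             ≈⟨ +-inverseˡ s ⟩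
    0#                  ∎

  -- Adding `x` only shifts the sequence of multiples, so their supremum bounds the translated
  -- sequence too.
  archimedean : ∀ {x w} → (∀ n → n ⋆ x ≤ w) → x ≤ 0#
  archimedean {x} {w} h with complete (_⋆ x) (w , h)
  ... | s , isSup = sup-translate isSup λ n → ≲-respˡ (x+n⋆x≈n⋆x+x n x) (proj₁ isSup (suc n))

  infix 4 _⊥_

  -- For nonnegative elements this says that their meet is zero; common lower bounds replace
  -- computations with meets.
  _⊥_ : Rel Carrier (c ⊔ ℓ₂)
  x ⊥ y = ∀ z → z ≤ x → z ≤ y → z ≤ 0#

  ⊥-sym : ∀ {x y} → x ⊥ y → y ⊥ x
  ⊥-sym h z z≤y z≤x = h z z≤x z≤y

  ⊥-antitone : ∀ {x y z w} → x ≤ z → y ≤ w → z ⊥ w → x ⊥ y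
  ⊥-antitone x≤z y≤w h t t≤x t≤y = h t (≤-trans t≤x x≤z) (≤-trans t≤y y≤w)

  0⊥ : ∀ {x} → 0# ⊥ x
  0⊥ z z≤0 _ = z≤0

  -- The element `- v + z + - w` is below `x` by the bound on `z`, and below `z`, hence `y`, because
  -- `v` and `w` are nonnegative. Disjointness makes it at most 0.
  ⊥-absorb : ∀ {v w x y z} → 0# ≤ v → 0# ≤ w → x ⊥ y → z ≤ v + x + w → z ≤ y → z ≤ v + w
  ⊥-absorb {v} {w} {x} {y} {z} 0≤v 0≤w x⊥y z≤ z≤y = moveˡ⁻ (≲-respʳ (+-identityˡ w) (moveʳ⁻
    (x⊥y (- v + z + - w)
      (moveʳ (moveˡ (≲-respʳ (+-assoc v x w) z≤)))
      (begin
        - v + z + - w   ≲⟨ +-mono (+-monoˡ z (-x≲0 0≤v)) (-x≲0 0≤w) ⟩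
        0# + z + 0#     ≈⟨ trans (+-identityʳ (0# + z)) (+-identityˡ z) ⟩
        z               ≲⟨ z≤y ⟩
        y               ∎))))

  ⊥-absorbˡ : ∀ {w x y z} → 0# ≤ w → x ⊥ y → z ≤ x + w → z ≤ y → z ≤ w
  ⊥-absorbˡ {w} {x} 0≤w x⊥y z≤ z≤y = ≤-trans
    (⊥-absorb ≤-refl 0≤w x⊥y (≤-trans z≤ (+-monoˡ w x≲0+x)) z≤y) 0+x≲x

  +-⊥ : ∀ {x y z} → 0# ≤ y → x ⊥ z → y ⊥ z → (x + y) ⊥ z
  +-⊥ 0≤y x⊥z y⊥z t t≤ t≤z = y⊥z t (⊥-absorbˡ 0≤y x⊥z t≤ t≤z) t≤z

  ⋆-⊥ : ∀ n {x y} → 0# ≤ x → x ⊥ y → (n ⋆ x) ⊥ y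
  ⋆-⊥ zero    0≤x x⊥y = 0⊥
  ⋆-⊥ (suc n) 0≤x x⊥y = +-⊥ (0≲n⋆x n 0≤x) x⊥y (⋆-⊥ n 0≤x x⊥y)

  ⋆-⊥-⋆ : ∀ m n {x y} → 0# ≤ x → 0# ≤ y → x ⊥ y → (m ⋆ x) ⊥ (n ⋆ y)
  ⋆-⊥-⋆ m n 0≤x 0≤y x⊥y = ⊥-sym (⋆-⊥ n 0≤y (⊥-sym (⋆-⊥ m 0≤x x⊥y)))

  0≤conj : ∀ z {x} → 0# ≤ x → 0# ≤ z + x + - z
  0≤conj z 0≤x = ≲-respˡ (+-inverseʳ z) (+-monoˡ (- z) (x≲x+y 0≤x))

  -- Every multiple of an element below both z + x - z and y is bounded by 2 ∣z∣.
  conj-⊥ : ∀ z {x y} → 0# ≤ x → 0# ≤ y → x ⊥ y → (z + x + - z) ⊥ y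
  conj-⊥ z {x} {y} 0≤x 0≤y x⊥y t t≤conj t≤y = ≤-trans (x≤x∨y t 0#) (archimedean λ n →
    ⊥-absorb 0≤w 0≤w (⋆-⊥-⋆ n n 0≤x 0≤y x⊥y)
      (begin
        n ⋆ (t ∨ 0#)            ≲⟨ ⋆-mono n (∨-least t≤conj (0≤conj z 0≤x)) ⟩
        n ⋆ (z + x + - z)       ≈⟨ conj-⋆ n z x ⟩
        z + n ⋆ x + - z         ≲⟨ +-mono (+-monoˡ (n ⋆ x) (≤-trans (x≤x∨y z (- z)) (x≤x∨y _ 0#)))
                                          (≤-trans (y≤x∨y z (- z)) (x≤x∨y _ 0#)) ⟩
        w + n ⋆ x + w           ∎)
      (⋆-mono n (∨-least t≤y 0≤y)))
    where
    w : Carrier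
    w = (z ∨ - z) ∨ 0#
    0≤w : 0# ≤ w
    0≤w = y≤x∨y _ 0#

  -- For a common lower bound `t`, both `x` and 0 lie below `x⁺ - t`: the former because the
  -- negative part is at most `- x + x⁺`, the latter because `t ≤ x⁺`. Hence `x⁺ ≤ x⁺ - t`.
  ⁺⊥⁻ : ∀ x → (x ∨ 0#) ⊥ (- x ∨ 0#)
  ⁺⊥⁻ x t t≤x⁺ t≤x⁻ = begin
    t                         ≈⟨ [y-x]+x≈y (x ∨ 0#) t ⟨
    t - x⁺ + x⁺               ≲⟨ +-monoʳ (t - x⁺) (∨-least x≤x⁺-t 0≤x⁺-t) ⟩
    t - x⁺ + (x⁺ - t)         ≈⟨ +-assoc t (- x⁺) (x⁺ - t) ⟩
    t + (- x⁺ + (x⁺ - t))     ≈⟨ +-congˡ (-x+[x+y]≈y x⁺ (- t)) ⟩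
    t - t                     ≈⟨ +-inverseʳ t ⟩
    0#                        ∎
    where
    infixl 6 _-_
    _-_ : Carrier → Carrier → Carrier
    v - w = v + - w
    x⁺ : Carrier
    x⁺ = x ∨ 0#
    0≤x⁺-t : 0# ≤ x⁺ - t
    0≤x⁺-t = ≲-respˡ (+-inverseʳ t) (+-monoˡ (- t) t≤x⁺)
    x⁻≤-x+x⁺ : - x ∨ 0# ≤ - x + x⁺
    x⁻≤-x+x⁺ = ∨-least (x≲x+y (y≤x∨y x 0#)) (≲-respˡ (+-inverseˡ x) (+-monoʳ (- x) (x≤x∨y x 0#)))
    x≤x⁺-t : x ≤ x⁺ - t
    x≤x⁺-t = ≲-respˡ ([y+x]-x≈y t x) (+-monoˡ (- t) (moveˡ⁻-x (≤-trans t≤x⁻ x⁻≤-x+x⁺)))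
      where
      moveˡ⁻-x : t ≤ - x + x⁺ → x + t ≤ x⁺
      moveˡ⁻-x h = ≲-respʳ (x+[-x+y]≈y x x⁺) (+-monoʳ x h)

  -- The preorder induced by the quotient of G by the polar of p.
  infix 4 _≤[_]_

  _≤[_]_ : Carrier → Carrier → Carrier → Set (c ⊔ ℓ₂)
  x ≤[ p ] y = ∃ λ e → 0# ≤ e × e ⊥ p × x ≤ e + y

  ≤⇒≤[] : ∀ {p x y} → x ≤ y → x ≤[ p ] y
  ≤⇒≤[] x≤y = 0# , ≤-refl , 0⊥ , ≤-trans x≤y x≲0+x

  ≤[]-antitone : ∀ {p q x y} → q ≤ p → x ≤[ p ] y → x ≤[ q ] y
  ≤[]-antitone q≤p (e , 0≤e , e⊥p , h) = e , 0≤e , ⊥-antitone ≤-refl q≤p e⊥p , h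

  -- Turns a forced inequality back into one of G: the error `e` is disjoint from `n ⋆ p`, so it
  -- contributes nothing above an element bounded by `n ⋆ p`.
  ≤[]⇒≤ : ∀ n {p x y} → 0# ≤ p → 0# ≤ y → x ≤[ p ] y → x ≤ n ⋆ p → x ≤ y
  ≤[]⇒≤ n 0≤p 0≤y (e , 0≤e , e⊥p , h) x≤np =
    ⊥-absorbˡ 0≤y (⊥-sym (⋆-⊥ n 0≤p (⊥-sym e⊥p))) h x≤np

  ≤[]-isGroupPreorder : ∀ {p} → 0# ≤ p → IsGroupPreorder _≤[ p ]_
  ≤[]-isGroupPreorder {p} 0≤p = record
    { isPreorder = record
      { isEquivalence = isEquivalence
      ; reflexive = ≤⇒≤[] ∘ ≤-reflexive
      ; trans = λ { {x} {y} {z} (d , 0≤d , d⊥p , x≤) (e , 0≤e , e⊥p , y≤) →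
          d + e , ≤-trans 0≤d (x≲x+y 0≤e) , +-⊥ 0≤e d⊥p e⊥p , (begin
            x             ≲⟨ x≤ ⟩
            d + y         ≲⟨ +-monoʳ d y≤ ⟩
            d + (e + z)   ≈⟨ +-assoc d e z ⟨
            d + e + z     ∎) }
      }
    -- The error passes `z` as its conjugate, which stays disjoint from `p` by `conj-⊥`.
    ; +-monoʳ = λ { z {x} {y} (e , 0≤e , e⊥p , x≤) →
        z + e + - z , 0≤conj z 0≤e , conj-⊥ z 0≤e 0≤p e⊥p , (begin
          z + x                       ≲⟨ +-monoʳ z x≤ ⟩
          z + (e + y)                 ≈⟨ +-assoc z e y ⟨
          z + e + y                   ≈⟨ +-congˡ (-x+[x+y]≈y z y) ⟨
          z + e + (- z + (z + y))     ≈⟨ +-assoc (z + e) (- z) (z + y) ⟨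
          z + e + - z + (z + y)       ∎) }
    ; +-monoˡ = λ { z {x} {y} (e , 0≤e , e⊥p , x≤) →
        e , 0≤e , e⊥p , ≲-respʳ (+-assoc e y z) (+-monoˡ z x≤) }
    }

  ∨-least[] : ∀ {p x y z} → x ≤[ p ] z → y ≤[ p ] z → x ∨ y ≤[ p ] z
  ∨-least[] {z = z} (d , 0≤d , d⊥p , x≤) (e , 0≤e , e⊥p , y≤) =
    d + e , ≤-trans 0≤d (x≲x+y 0≤e) , +-⊥ 0≤e d⊥p e⊥p ,
    ∨-least (≤-trans x≤ (+-monoˡ z (x≲x+y 0≤e))) (≤-trans y≤ (+-monoˡ z (x≲y+x 0≤d)))

-- Conditions and the forcing dichotomy

module Forcing (em : ∀ {a} → ExcludedMiddle a) {c ℓ₁ ℓ₂} (G : ℓ-Group c ℓ₁ ℓ₂)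
  (complete : DedekindσComplete (ℓ-Group.poset G)) where
  open Archimedean G complete public

  record Condition : Set (c ⊔ ℓ₂) where
    field
      element  : Carrier
      positive : 0# ≤ element
      nonzero  : ¬ (element ≤ 0#)

  open Condition public

  forced-isGroupPreorder : ∀ p → IsGroupPreorder _≤[ element p ]_
  forced-isGroupPreorder p = ≤[]-isGroupPreorder (positive p)

  infix 4 _⊑_
  _⊑_ : Rel Condition ℓ₂
  q ⊑ p = element q ≤ element p

  forced-antitone : ∀ {p q x y} → q ⊑ p → x ≤[ element p ] y → x ≤[ element q ] y
  forced-antitone = ≤[]-antitone

  -- Let t = x - y. If `p` meets the negative part of `t`, the meet is a condition disjoint from the
  -- positive part, which then serves as the error in forcing `x` below `y`. Otherwise the negative
  -- part is itself disjoint from `p` and is the error for the reverse inequality. Consequently, if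
  -- no stronger condition forces `x` below `y`, then `p` already forces `y` below `x`.
  dichotomy : ∀ p x y → (∃ λ q → q ⊑ p × x ≤[ element q ] y) ⊎ y ≤[ element p ] x
  dichotomy p x y with em {P = element p ∧ (- (x + - y) ∨ 0#) ≤ 0#}
  ... | no ≰0 = inj₁
    ( record { element = q ; positive = ∧-greatest (positive p) (y≤x∨y _ 0#) ; nonzero = ≰0 }
    , x∧y≤x _ _
    , t ∨ 0# , y≤x∨y t 0# , ⊥-antitone ≤-refl (x∧y≤y _ _) (⁺⊥⁻ t) , moveʳ⁻ (x≤x∨y t 0#))
    where
    t q : Carrier
    t = x + - y
    q = element p ∧ (- t ∨ 0#)
  ... | yes ≤0 = inj₂
    ( - t ∨ 0# , y≤x∨y (- t) 0#
    , (λ z z≤t⁻ z≤p → ≤-trans (∧-greatest z≤p z≤t⁻) ≤0)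
    , (begin
        y               ≈⟨ [y-x]+x≈y x y ⟨
        y + - x + x     ≈⟨ +-congʳ (+-congʳ (-‿involutive y)) ⟨
        - - y + - x + x ≈⟨ +-congʳ (-[x+y]≈-y-x x (- y)) ⟨
        - t + x         ≲⟨ +-monoˡ x (x≤x∨y (- t) 0#) ⟩
        (- t ∨ 0#) + x  ∎))
    where
    open PreorderReasoning preorder
    t : Carrier
    t = x + - y

-- Dense sets of conditions

module Density (em : ∀ {a} → ExcludedMiddle a) {c ℓ₁ ℓ₂} (G : ℓ-Group c ℓ₁ ℓ₂)
  (complete : DedekindσComplete (ℓ-Group.poset G))
  (u : ℓ-Group.Carrier G) (weakUnit : IsWeakUnit G u) where
  open Forcing em G complete public
  open IsGroupPreorder using ()
    renaming (≲-trans to transᴼ; -‿anti to antiᴼ; ⋆-mono to ⋆-monoᴼ; +-monoˡ to monoˡᴼ)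
  open PreorderReasoning preorder

  0≤u : 0# ≤ u
  0≤u = proj₁ weakUnit

  -- The defining implication of a weak unit enters here; `dense-bounded` and `dense-approximation`
  -- end in a contradiction with this lemma.
  meet-nonzero : ∀ p → ¬ (element p ∧ u ≤ 0#)
  meet-nonzero p p∧u≤0 = nonzero p (≤-reflexive
    (proj₂ weakUnit (element p) (antisym p∧u≤0 (∧-greatest (positive p) 0≤u))))

  -- Keeps the generic preorder nontrivial. Since `element p ∧ u` lies below `element p`, forcing it
  -- below 0 would make it at most 0 in G.
  u⋠0 : ∀ p → ¬ (u ≤[ element p ] 0#)
  u⋠0 p u≼0 = meet-nonzero p (≤[]⇒≤ 1 (positive p) ≤-refl
    (transᴼ (forced-isGroupPreorder p) (≤⇒≤[] (x∧y≤y _ u)) u≼0)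
    (≤-trans (x∧y≤x _ u) x≲x+0))

  -- Otherwise `p` forces every `n ⋆ u` below `x` by `dichotomy`. Then all multiples of
  -- `element p ∧ u` lie below `x ∨ 0#`, against the archimedean property.
  dense-bounded : ∀ p x → ∃ λ q → q ⊑ p × ∃ λ n → x ≤[ element q ] n ⋆ u
  dense-bounded p x with em {P = ∃ λ n → ∃ λ q → q ⊑ p × x ≤[ element q ] n ⋆ u}
  ... | yes (n , q , q⊑p , x≼nu) = q , q⊑p , n , x≼nu
  ... | no unbounded = contradiction (archimedean nm≤x⁺) (meet-nonzero p)
    where
    nu≼x : ∀ n → n ⋆ u ≤[ element p ] x
    nu≼x n with dichotomy p x (n ⋆ u)
    ... | inj₁ (q , q⊑p , x≼nu) = contradiction (n , q , q⊑p , x≼nu) unbounded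
    ... | inj₂ h = h
    nm≤x⁺ : ∀ n → n ⋆ (element p ∧ u) ≤ x ∨ 0#
    nm≤x⁺ n = ≤[]⇒≤ n (positive p) (y≤x∨y x 0#)
      (transᴼ (forced-isGroupPreorder p) (≤⇒≤[] (⋆-mono n (x∧y≤y _ u)))
        (transᴼ (forced-isGroupPreorder p) (nu≼x n) (≤⇒≤[] (x≤x∨y x 0#))))
      (⋆-mono n (x∧y≤x _ u))

  Bracketed : Condition → Carrier → Set (c ⊔ ℓ₂)
  Bracketed p x = ∃ λ a → (a · u ≤[ element p ] x) × (x ≤[ element p ] ℤ.suc a · u)

  -- A linear search upwards from `a`, with `k` the distance to the upper bound: either some
  -- stronger condition forces `x` below the next multiple of `u`, or the lower bound rises by one.
  dense-bisect : ∀ p x k a → a · u ≤[ element p ] x → x ≤[ element p ] (+ k ℤ.+ a) · u →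
                 ∃ λ q → q ⊑ p × Bracketed q x
  dense-bisect p x zero a a≼x x≼ = p , ≤-refl , a , a≼x , transᴼ (forced-isGroupPreorder p) x≼
    (≤⇒≤[] (·-monoˡ 0≤u (subst (ℤ._≤ ℤ.suc a) (≡.sym (ℤ.+-identityˡ a)) (ℤ.i≤suc[i] a))))
  dense-bisect p x (suc k) a a≼x x≼ with dichotomy p x (ℤ.suc a · u)
  ... | inj₁ (q , q⊑p , x≼suc) = q , q⊑p , a , forced-antitone {p} {q} q⊑p a≼x , x≼suc
  ... | inj₂ suc≼x = dense-bisect p x k (ℤ.suc a) suc≼x
    (subst (λ b → x ≤[ element p ] b · u)
      (solve 2 (λ k a → (con 1ℤ :+ k) :+ a := k :+ (con 1ℤ :+ a)) ≡.refl (+ k) a) x≼)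
    where open ℤ-Solver

  dense-bracketed : ∀ p x → ∃ λ q → q ⊑ p × Bracketed q x
  dense-bracketed p x with dense-bounded p x
  -- A bound `m ⋆ u` for `- x` gives the lower bound -m for `x`, so the search starts there at
  -- distance m + n from the upper bound.
  ... | q , q⊑p , n , x≼nu with dense-bounded q (- x)
  ... | r , r⊑q , m , -x≼mu with dense-bisect r x (m ℕ.+ n) (ℤ.- (+ m)) lower upper
    where
    O : IsGroupPreorder _≤[ element r ]_
    O = forced-isGroupPreorder r
    lower : (ℤ.- (+ m)) · u ≤[ element r ] x
    lower = transᴼ O (≤⇒≤[] (≤-reflexive (·-neg m u)))
      (transᴼ O (antiᴼ O -x≼mu) (≤⇒≤[] (≤-reflexive (-‿involutive x))))
    upper : x ≤[ element r ] (+ (m ℕ.+ n) ℤ.+ ℤ.- (+ m)) · u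
    upper = subst (λ b → x ≤[ element r ] b · u)
      (solve 2 (λ m n → n := (m :+ n) :+ :- m) ≡.refl (+ m) (+ n))
      (forced-antitone {q} {r} r⊑q x≼nu)
      where open ℤ-Solver
  ... | t , t⊑r , b = t , ≤-trans t⊑r (≤-trans r⊑q q⊑p) , b

  -- For fixed `m`, the bound at index `m ℕ.⊔ n` splits into `d m` plus `k ⋆ d n`, because `d`
  -- decreases. Induction over all `n` gives `x ≤ d m`, and then `m` varies.
  ⋆-inf≤0 : ∀ {d : ℕ → Carrier} → (∀ {m n} → m ℕ.≤ n → d n ≤ d m) →
            (∀ x → (∀ n → x ≤ d n) → x ≤ 0#) →
            ∀ k x → (∀ n → x ≤ k ⋆ d n) → x ≤ 0#
  ⋆-inf≤0 d-anti inf≤0 zero    x x≤ = x≤ 0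
  ⋆-inf≤0 {d} d-anti inf≤0 (suc k) x x≤ = inf≤0 x λ m → ≤-trans
    (moveˡ⁻ (⋆-inf≤0 d-anti inf≤0 k (- d m + x) λ n → moveˡ (begin
      x                                 ≲⟨ x≤ (m ℕ.⊔ n) ⟩
      d (m ℕ.⊔ n) + k ⋆ d (m ℕ.⊔ n)     ≲⟨ +-mono (d-anti (ℕ.m≤m⊔n m n))
                                                (⋆-mono k (d-anti (ℕ.m≤n⊔m m n))) ⟩
      d m + k ⋆ d n                     ∎)))
    x+0≲x

  partialJoin : (ℕ → Carrier) → ℕ → Carrier
  partialJoin f zero    = f zero
  partialJoin f (suc n) = partialJoin f n ∨ f (suc n)

  f≤partialJoin : ∀ f n → f n ≤ partialJoin f n
  f≤partialJoin f zero    = ≤-refl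
  f≤partialJoin f (suc n) = y≤x∨y _ _

  partialJoin-mono′ : ∀ f {m n} → m ℕ.≤′ n → partialJoin f m ≤ partialJoin f n
  partialJoin-mono′ f ℕ.≤′-refl       = ≤-refl
  partialJoin-mono′ f (ℕ.≤′-step m≤n) = ≤-trans (partialJoin-mono′ f m≤n) (x≤x∨y _ _)

  partialJoin-least : ∀ f {b} → (∀ n → f n ≤ b) → ∀ n → partialJoin f n ≤ b
  partialJoin-least f ub zero    = ub zero
  partialJoin-least f ub (suc n) = ∨-least (partialJoin-least f ub n) (ub (suc n))

  -- Finitely many applications of `dichotomy` force one of the terms to be the largest.
  dense-partialJoin : ∀ p f n → ∃ λ q → q ⊑ p × ∃ λ i → partialJoin f n ≤[ element q ] f i
  dense-partialJoin p f zero    = p , ≤-refl , 0 , ≤⇒≤[] ≤-refl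
  dense-partialJoin p f (suc n) with dense-partialJoin p f n
  ... | q , q⊑p , i , F≼fi with dichotomy q (f (suc n)) (f i)
  ... | inj₁ (r , r⊑q , f≼fi) = r , ≤-trans r⊑q q⊑p , i , ∨-least[] (forced-antitone {q} {r} r⊑q F≼fi) f≼fi
  ... | inj₂ fi≼f = q , q⊑p , suc n ,
    ∨-least[] (transᴼ (forced-isGroupPreorder q) F≼fi fi≼f) (≤⇒≤[] ≤-refl)

  -- With the partial joins F n of f, the differences s - F n decrease to 0, so
  -- for fixed k nothing nonzero and positive lies below k ⋆ (s - F n) for all n.
  dense-approximation : ∀ {f s} → IsSupremum poset f s → ∀ p k →
                        ∃ λ q → q ⊑ p × ∃ λ i → k ⋆ (- f i + s) ≤[ element q ] u
  dense-approximation {f} {s} (ub , least) p k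
    with em {P = ∃ λ n → ∃ λ q → q ⊑ p × k ⋆ (- partialJoin f n + s) ≤[ element q ] u}
  ... | no none = contradiction
    (⋆-inf≤0 {d = λ n → - partialJoin f n + s}
      (λ m≤n → +-monoˡ s (-‿anti (partialJoin-mono′ f (ℕ.≤⇒≤′ m≤n))))
      inf≤0 k (element p ∧ u) p∧u≤)
    (meet-nonzero p)
    where
    u≼ : ∀ n → u ≤[ element p ] k ⋆ (- partialJoin f n + s)
    u≼ n with dichotomy p (k ⋆ (- partialJoin f n + s)) u
    ... | inj₁ (q , q⊑p , h) = contradiction (n , q , q⊑p , h) none
    ... | inj₂ h = h
    p∧u≤ : ∀ n → element p ∧ u ≤ k ⋆ (- partialJoin f n + s)
    p∧u≤ n = ≤[]⇒≤ 1 (positive p)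
      (0≲n⋆x k (x≲y⇒0≲-x+y (partialJoin-least f ub n)))
      (transᴼ (forced-isGroupPreorder p) (≤⇒≤[] (x∧y≤y _ u)) (u≼ n))
      (≤-trans (x∧y≤x _ u) x≲x+0)
    inf≤0 : ∀ x → (∀ n → x ≤ - partialJoin f n + s) → x ≤ 0#
    inf≤0 x x≤ = sup-translate (ub , least) λ n → ≤-trans (+-monoˡ x (f≤partialJoin f n)) (F+x≤s n)
      where
      F+x≤s : ∀ n → partialJoin f n + x ≤ s
      F+x≤s n = ≲-respʳ (x+[-x+y]≈y (partialJoin f n) s) (+-monoʳ (partialJoin f n) (x≤ n))
  ... | yes (n , q , q⊑p , h) with dense-partialJoin q f n
  -- The partial join is forced below the single term `f i`, so the gap from `f i` to `s` is forced
  -- below the gap from the partial join.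
  ... | r , r⊑q , i , F≼fi = r , ≤-trans r⊑q q⊑p , i ,
    transᴼ O (⋆-monoᴼ O k (monoˡᴼ O s (antiᴼ O F≼fi))) (forced-antitone {q} {r} r⊑q h)
    where
    O : IsGroupPreorder _≤[ element r ]_
    O = forced-isGroupPreorder r

  -- Supplies the initial condition under which `x` gets a value of at least 1/(n + 1). If there
  -- were none, the condition `x ∨ 0#` would force every `suc n ⋆ x` below `u`; as it also forces
  -- `x ∨ 0#` below `x`, all multiples of `x ∨ 0#` would lie below `u`.
  positive-gap : ∀ {x} → ¬ (x ≤ 0#) → ∃ λ p → ∃ λ n → u ≤[ element p ] suc n ⋆ x
  positive-gap {x} x≰0 with em {P = ∃ λ p → ∃ λ n → u ≤[ element p ] suc n ⋆ x}
  ... | yes gap = gap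
  ... | no no-gap = contradiction (≤-trans (x≤x∨y x 0#) (archimedean np≤u)) x≰0
    where
    p : Condition
    p = record
      { element  = x ∨ 0#
      ; positive = y≤x∨y x 0#
      ; nonzero  = λ h → x≰0 (≤-trans (x≤x∨y x 0#) h)
      }
    O : IsGroupPreorder _≤[ element p ]_
    O = forced-isGroupPreorder p
    p≼x : element p ≤[ element p ] x
    p≼x = - x ∨ 0# , y≤x∨y _ 0# , ⊥-sym (⁺⊥⁻ x) ,
      ∨-least (x≲y+x (y≤x∨y _ 0#)) (≲-respˡ (+-inverseˡ x) (+-monoˡ x (x≤x∨y (- x) 0#)))
    nx≼u : ∀ n → suc n ⋆ x ≤[ element p ] u
    nx≼u n with dichotomy p u (suc n ⋆ x)
    ... | inj₁ (q , _ , h) = contradiction (q , n , h) no-gap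
    ... | inj₂ h = h
    np≤u : ∀ n → n ⋆ element p ≤ u
    np≤u zero    = 0≤u
    np≤u (suc n) = ≤[]⇒≤ (suc n) (positive p) 0≤u
      (transᴼ O (⋆-monoᴼ O (suc n) p≼x) (nx≼u n)) ≤-refl

-- Runs through the antidiagonals of ℕ × ℕ.
unpair : ℕ → ℕ × ℕ
unpair zero    = 0 , 0
unpair (suc k) = next (unpair k)
  where
  next : ℕ × ℕ → ℕ × ℕ
  next (zero  , n) = suc n , zero
  next (suc m , n) = m , suc n

unpair-surjective : StrictlySurjective _≡_ unpair
unpair-surjective (m , n) = diagonal n m (axis (n ℕ.+ m))
  where
  Reached : ℕ → ℕ → Set
  Reached m n = ∃ λ k → unpair k ≡ (m , n)
  diagonal : ∀ n m → Reached (n ℕ.+ m) 0 → Reached m n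
  diagonal zero    m h = h
  diagonal (suc n) m h with diagonal n (suc m) (subst (λ t → Reached t 0) (≡.sym (ℕ.+-suc n m)) h)
  ... | k , eq = suc k , step eq
    where
    step : unpair k ≡ (suc m , n) → unpair (suc k) ≡ (m , suc n)
    step eq rewrite eq = ≡.refl
  axis : ∀ m → Reached m 0
  axis zero = 0 , ≡.refl
  axis (suc m) with diagonal m 0 (subst (λ t → Reached t 0) (≡.sym (ℕ.+-identityʳ m)) (axis m))
  ... | k , eq = suc k , step eq
    where
    step : unpair k ≡ (0 , m) → unpair (suc k) ≡ (suc m , 0)
    step eq rewrite eq = ≡.refl

-- From σ-continuity and additivity to ℓ-homomorphisms

module ℓ-Homomorphisms {a b ℓ₁ ℓ₂ ℓ₃ ℓ₄} (G : ℓ-Group a ℓ₁ ℓ₂) (H : ℓ-Group b ℓ₃ ℓ₄) where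
  private
    module G = ℓ-GroupOrder G
    module GO = G.IsGroupPreorder G.≤-isGroupPreorder
    module H = ℓ-GroupOrder H
    module HO = H.IsGroupPreorder H.≤-isGroupPreorder

  -- Binary joins and equal elements are suprema of sequences, and meets are
  -- negated joins.
  σ-continuous+additive⇒ℓ-homomorphism : ∀ (h : G.Carrier → H.Carrier) →
    σ-Continuous G.poset H.poset h → (∀ x y → h (x G.+ y) H.≈ h x H.+ h y) →
    Isℓ-Homomorphism G H h
  σ-continuous+additive⇒ℓ-homomorphism h continuous homo = record
    { isGroupHomomorphism = record
      { isMonoidHomomorphism = record
        { isMagmaHomomorphism = record
          { isRelHomomorphism = record { cong = h-cong } ; homo = homo }
        ; ε-homo = h-0
        }
      ; ⁻¹-homo = h-neg
      }
    ; isLatticeHomomorphism = record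
      { isRelHomomorphism = record { cong = h-cong }
      ; ∧-homo = λ x y → H.antisym
          (H.∧-greatest (h-mono (G.x∧y≤x x y)) (h-mono (G.x∧y≤y x y)))
          (HO.-‿cancel (HO.≲-respˡ (h-neg (x G.∧ y)) (proj₂ (h-pair (-∧-isSup x y)) _ λ where
            zero    → HO.≲-respˡ (H.sym (h-neg x)) (HO.-‿anti (H.x∧y≤x _ _))
            (suc _) → HO.≲-respˡ (H.sym (h-neg y)) (HO.-‿anti (H.x∧y≤y _ _)))))
      ; ∨-homo = λ x y → let ub , least = h-pair (∨-isSup x y) in H.antisym
          (least _ λ { zero → H.x≤x∨y _ _ ; (suc _) → H.y≤x∨y _ _ })
          (H.∨-least (ub 0) (ub 1))
      }
    }
    where
    pair : ∀ {ℓ} {A : Set ℓ} → A → A → ℕ → A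
    pair x y zero    = x
    pair x y (suc _) = y

    h-pair : ∀ {x y s} → IsSupremum G.poset (pair x y) s →
             IsSupremum H.poset (pair (h x) (h y)) (h s)
    h-pair isSup with continuous _ _ isSup
    ... | ub , least =
        (λ { zero → ub 0 ; (suc n) → ub (suc n) })
      , λ b le → least b λ { zero → le 0 ; (suc n) → le (suc n) }

    ∨-isSup : ∀ x y → IsSupremum G.poset (pair x y) (x G.∨ y)
    ∨-isSup x y =
        (λ { zero → G.x≤x∨y x y ; (suc _) → G.y≤x∨y x y })
      , λ b le → G.∨-least (le 0) (le 1)

    -∧-isSup : ∀ x y → IsSupremum G.poset (pair (G.- x) (G.- y)) (G.- (x G.∧ y))
    -∧-isSup x y =
        (λ { zero → GO.-‿anti (G.x∧y≤x x y) ; (suc _) → GO.-‿anti (G.x∧y≤y x y) })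
      , λ b le → GO.-‿antiˡ (G.∧-greatest (GO.-‿antiˡ (le 0)) (GO.-‿antiˡ (le 1)))

    h-mono : ∀ {x y} → x G.≤ y → h x H.≤ h y
    h-mono x≤y = proj₁ (h-pair ((λ { zero → x≤y ; (suc _) → GO.≲-refl }) , λ b le → le 1)) 0

    h-cong : ∀ {x y} → x G.≈ y → h x H.≈ h y
    h-cong x≈y = H.antisym (h-mono (GO.≲-reflexive x≈y)) (h-mono (GO.≲-reflexive (G.sym x≈y)))

    h-0 : h G.0# H.≈ H.0#
    h-0 = identityˡ-unique (h G.0#) (h G.0#)
      (H.trans (H.sym (homo G.0# G.0#)) (h-cong (G.+-identityˡ G.0#)))
      where open GroupProperties H.group

    h-neg : ∀ x → h (G.- x) H.≈ H.- h x
    h-neg x = inverseˡ-unique (h (G.- x)) (h x)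
      (H.trans (H.sym (homo (G.- x) x)) (H.trans (h-cong (G.+-inverseˡ x)) h-0))
      where open GroupProperties H.group

-- Generic sequences for countably many dense sets

module RasiowaSikorski {a r d} {A : Set a} {_⊑_ : Rel A r}
  (⊑-refl : Reflexive _⊑_) (⊑-trans : Transitive _⊑_)
  {D : ℕ → Pred A d} (dense : ∀ n p → ∃ λ q → q ⊑ p × D n q) (p₀ : A) where

  generic : ℕ → A
  generic zero    = p₀
  generic (suc n) = proj₁ (dense n (generic n))

  generic-met : ∀ n → D n (generic (suc n))
  generic-met n = proj₂ (proj₂ (dense n (generic n)))

  generic-antitone′ : ∀ {m n} → m ℕ.≤′ n → generic n ⊑ generic m
  generic-antitone′ ℕ.≤′-refl           = ⊑-refl
  generic-antitone′ (ℕ.≤′-step {n} m≤n) = ⊑-trans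
    (proj₁ (proj₂ (dense n (generic n)))) (generic-antitone′ m≤n)

  generic-antitone : ∀ {m n} → m ℕ.≤ n → generic n ⊑ generic m
  generic-antitone = generic-antitone′ ∘ ℕ.≤⇒≤′

-- The representation

module Representation (em : ∀ {a} → ExcludedMiddle a) {c ℓ₁ ℓ₂} (G : ℓ-Group c ℓ₁ ℓ₂)
  (complete : DedekindσComplete (ℓ-Group.poset G))
  (u : ℓ-Group.Carrier G) (weakUnit : IsWeakUnit G u) where
  open Density em G complete u weakUnit

  -- Laws and the dense requirements behind them

  data Law : Set (c ⊔ ℓ₁ ⊔ ℓ₂) where
    unit : Law
    add  : (x y : Carrier) → Law
    sup  : (f : ℕ → Carrier) (s : Carrier) → IsSupremum poset f s → Law

  Holds : Law → Pred (Carrier → ℝ) 0ℓ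
  Holds unit        v = v u ≈ʳ 1ʳ
  Holds (add x y)   v = v (x + y) ≈ʳ v x +ʳ v y
  Holds (sup f s _) v = (∀ n → v (f n) ≤ʳ v s) × (∀ r → (∀ n → v (f n) ≤ʳ r) → v s ≤ʳ r)

  -- Each task is a dense set of conditions: brackets make elements located, comparisons supply the
  -- commutation for `eval-+`, and approximations let the terms of a sequence come close to its
  -- supremum.
  data Task : Set (c ⊔ ℓ₁ ⊔ ℓ₂) where
    bracket     : (x : Carrier) (m : ℕ) → Task
    compare     : (x y : Carrier) → Task
    approximate : (f : ℕ → Carrier) (s : Carrier) → IsSupremum poset f s → (m : ℕ) → Task

  Met : Task → Pred Condition (c ⊔ ℓ₂)
  Met (bracket x m)           p = Bracketed p (suc m ⋆ x)
  Met (compare x y)           p = x + y ≤[ element p ] y + x ⊎ y + x ≤[ element p ] x + y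
  Met (approximate f s _ m)   p = ∃ λ i → suc m ⋆ (- f i + s) ≤[ element p ] u

  dense-met : ∀ t p → ∃ λ q → q ⊑ p × Met t q
  dense-met (bracket x m) p = dense-bracketed p (suc m ⋆ x)
  dense-met (compare x y) p with dichotomy p (x + y) (y + x)
  ... | inj₁ (q , q⊑p , h) = q , q⊑p , inj₁ h
  ... | inj₂ h             = p , ≤-refl , inj₂ h
  dense-met (approximate f s isSup m) p = dense-approximation isSup p (suc m)

  -- Lists what `met⇒holds` asks for each law, with `i` the index of a term and `m` the precision.
  -- For a supremum, the gap `- f i + s` is bracketed and compared with `f i` so that `eval` is
  -- additive on `s = f i + (- f i + s)`.
  tasks : Law → (kind i m : ℕ) → Task
  tasks unit            _ _ m = bracket u m
  tasks (add x y)       0 _ m = bracket x m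
  tasks (add x y)       1 _ m = bracket y m
  tasks (add x y)       2 _ m = bracket (x + y) m
  tasks (add x y)       _ _ _ = compare x y
  tasks (sup f s isSup) 0 _ m = bracket s m
  tasks (sup f s isSup) 1 _ m = approximate f s isSup m
  tasks (sup f s isSup) 2 i m = bracket (f i) m
  tasks (sup f s isSup) 3 i m = bracket (- f i + s) m
  tasks (sup f s isSup) _ i _ = compare (f i) (- f i + s)

  -- The generic preorder and its evaluation

  module Generic (laws : ℕ → Law) (p₀ : Condition) where

    task : ℕ → Task
    task k = let l , k′ = unpair k ; kind , k″ = unpair k′ ; i , m = unpair k″ in
      tasks (laws l) kind i m

    task-surjective : ∀ l kind i m → ∃ λ k → task k ≡ tasks (laws l) kind i m
    task-surjective l kind i m =
      let k″ , eq″ = unpair-surjective (i , m)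
          k′ , eq′ = unpair-surjective (kind , k″)
          k  , eq  = unpair-surjective (l , k′)
      in k , unfold {k} eq eq′ eq″
      where
      unfold : ∀ {k k′ k″} → unpair k ≡ (l , k′) → unpair k′ ≡ (kind , k″) → unpair k″ ≡ (i , m) →
               task k ≡ tasks (laws l) kind i m
      unfold eq eq′ eq″ rewrite eq | eq′ | eq″ = ≡.refl

    ⊑-trans : Transitive _⊑_
    ⊑-trans r⊑q q⊑p = ≤-trans r⊑q q⊑p

    dense-task : ∀ k p → ∃ λ q → q ⊑ p × Met (task k) q
    dense-task k = dense-met (task k)

    open RasiowaSikorski {_⊑_ = _⊑_} ≤-refl (λ {r} {q} {p} → ⊑-trans {r} {q} {p}) dense-task p₀

    Eventually-met : Task → Set (c ⊔ ℓ₂)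
    Eventually-met t = ∃ λ n → Met t (generic n)

    eventually-met : ∀ l kind i m → Eventually-met (tasks (laws l) kind i m)
    eventually-met l kind i m with task-surjective l kind i m
    ... | k , eq = suc k , subst (λ t → Met t (generic (suc k))) eq (generic-met k)

    infix 4 _≲_
    -- The union of the preorders forced along the generic sequence, which grow as the conditions
    -- shrink.
    _≲_ : Rel Carrier (c ⊔ ℓ₂)
    x ≲ y = ∃ λ n → x ≤[ element (generic n) ] y

    ≲-isGroupPreorder : IsGroupPreorder _≲_
    ≲-isGroupPreorder = record
      { isPreorder = record
        { isEquivalence = isEquivalence
        ; reflexive = λ x≈y → 0 , ≤⇒≤[] (≤-reflexive x≈y)
        ; trans = λ { (m , x≤y) (n , y≤z) → m ℕ.⊔ n ,
            IsGroupPreorder.≲-trans (forced-isGroupPreorder (generic (m ℕ.⊔ n)))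
              (≤[]-antitone (generic-antitone (ℕ.m≤m⊔n m n)) x≤y)
              (≤[]-antitone (generic-antitone (ℕ.m≤n⊔m m n)) y≤z) }
        }
      ; +-monoʳ = λ { z (n , h) → n , IsGroupPreorder.+-monoʳ (forced-isGroupPreorder (generic n)) z h }
      ; +-monoˡ = λ { z (n , h) → n , IsGroupPreorder.+-monoˡ (forced-isGroupPreorder (generic n)) z h }
      }

    ≤⇒≲ : ∀ {x y} → x ≤ y → x ≲ y
    ≤⇒≲ x≤y = 0 , ≤⇒≤[] x≤y

    u≴0 : ¬ (u ≲ 0#)
    u≴0 (n , h) = u⋠0 (generic n) h

    open Hölder group em ≲-isGroupPreorder u (≤⇒≲ 0≤u) u≴0 public

    met⇒located : ∀ {x} → (∀ m → Eventually-met (bracket x m)) → Located x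
    met⇒located met m with met m
    ... | n , a , lower , upper = a , (n , lower) , (n , upper)

    met⇒comparable : ∀ {x y} → Eventually-met (compare x y) → x + y ≲ y + x ⊎ y + x ≲ x + y
    met⇒comparable (n , inj₁ h) = inj₁ (n , h)
    met⇒comparable (n , inj₂ h) = inj₂ (n , h)

    located-resp : ∀ {x y} → x ≈ y → Located x → Located y
    located-resp x≈y L m with L m
    ... | a , lower , upper = a ,
      O.≲-respʳ (×-congʳ (suc m) x≈y) lower , O.≲-respˡ (×-congʳ (suc m) x≈y) upper
      where module O = IsGroupPreorder ≲-isGroupPreorder

    met⇒holds : ∀ law → (∀ kind i m → Eventually-met (tasks law kind i m)) → Holds law eval
    met⇒holds unit met = eval-u (met⇒located (met 0 0))
    met⇒holds (add x y) met = eval-+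
      (met⇒located (met 0 0)) (met⇒located (met 1 0)) (met⇒located (met 2 0))
      (met⇒comparable (met 3 0 0))
    met⇒holds (sup f s isSup) met =
        (λ i → eval-mono (locf i) locs (≤⇒≲ (proj₁ isSup i)))
      -- The approximation task gives an index `i` with `suc m ⋆ (- f i + s) ≲ u`. The gap then has
      -- value at most 1/(m + 1), and `s` has value at most that of `f i` plus this error.
      , λ r ub → squeeze {eval s} {r} λ m → let n , i , h = met 1 0 m in
          ≤ʳ-weaken {eval s} {r} m
            (≤ʳ-trans {eval s} {eval (f i) +ʳ eval (- f i + s)} {r +ʳ fromℚ (1ℤ / suc m)}
              (eval-s≤ i)
              (+ʳ-mono {eval (f i)} {r} {eval (- f i + s)} {fromℚ (1ℤ / suc m)} (ub i)
                (upper⇒eval≤ (locd i) 1ℤ m (O.≲-trans (n , h) O.x≲x+0))))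
      where
      module O = IsGroupPreorder ≲-isGroupPreorder
      locs : Located s
      locs = met⇒located (met 0 0)
      locf : ∀ i → Located (f i)
      locf i = met⇒located (met 2 i)
      locd : ∀ i → Located (- f i + s)
      locd i = met⇒located (met 3 i)
      loc+ : ∀ i → Located (f i + (- f i + s))
      loc+ i = located-resp (sym (x+[-x+y]≈y (f i) s)) locs
      eval-s≤ : ∀ i → eval s ≤ʳ eval (f i) +ʳ eval (- f i + s)
      eval-s≤ i = ≤ʳ-trans {eval s} {eval (f i + (- f i + s))} {eval (f i) +ʳ eval (- f i + s)}
        (eval-mono locs (loc+ i) (O.≲-reflexive (sym (x+[-x+y]≈y (f i) s))))
        (≈ʳ⇒≤ʳ {eval (f i + (- f i + s))} {eval (f i) +ʳ eval (- f i + s)}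
          (eval-+ (locf i) (locd i) (loc+ i) (met⇒comparable (met 4 i 0))))

    eval-holds : ∀ l → Holds (laws l) eval
    eval-holds l = met⇒holds (laws l) (eventually-met l)

  -- The generic sequence starts at the condition from `positive-gap`, so `u ≲ suc n ⋆ x` holds in
  -- the generic preorder and bounds `eval x` below by 1/(n + 1).
  separate : ∀ {x} → ¬ (x ≤ 0#) → ∀ (laws : ℕ → Law) →
             ∃ λ v → (∀ n → Holds (laws n) v) × ¬ (v x ≈ʳ 0ʳ)
  separate {x} x≰0 laws with positive-gap x≰0
  ... | p , n , u≼nx = eval , eval-holds ∘ suc , λ eval≈0 →
    1/n≰0 n (≤ʳ-trans {fromℚ (1ℤ / suc n)} {eval x} {0ʳ}
      -- The gap holds at index 0 because `generic 0` is `p`; the term `1ℤ · u` unfolds to `u + 0#`.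
      (lower⇒≤eval (met⇒located (eventually-met 0 0 0)) 1ℤ n (O.≲-trans (0 , u+0≼nx) O.≲-refl))
      (≈ʳ⇒≤ʳ {eval x} {0ʳ} eval≈0))
    where
    -- The additional law makes x located.
    laws′ : ℕ → Law
    laws′ zero    = add x x
    laws′ (suc n) = laws n
    open Generic laws′ p
    module O = IsGroupPreorder ≲-isGroupPreorder
    u+0≼nx : u + 0# ≤[ element p ] suc n ⋆ x
    u+0≼nx = IsGroupPreorder.≲-respˡ (forced-isGroupPreorder p) (sym (+-identityʳ u)) u≼nx

  -- The wrapper lifts `Carrier → ℝ` from level `c` to the level of `Law`.
  record Point : Set (c ⊔ ℓ₁ ⊔ ℓ₂) where
    constructor point
    field at : Carrier → ℝ

  open Point

  -- A null set carries its sequence of laws as data, so for a countable union the sequences are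
  -- merely interleaved through `unpair`.
  lawless : σ-Ideal Point (c ⊔ ℓ₁ ⊔ ℓ₂)
  lawless = record
    { Null   = λ S → Σ (ℕ → Law) λ laws → ∀ v → S v → ∃ λ n → ¬ Holds (laws n) (at v)
    ; ∅-null = (λ _ → unit) , λ _ ()
    ; ⊆-null = λ { S⊆T (laws , h) → laws , λ v Sv → h v (S⊆T Sv) }
    ; ⋃-null = λ S nulls →
        (λ k → let i , j = unpair k in proj₁ (nulls i) j)
      , λ { v (i , Sv) →
          let j , fails = proj₂ (nulls i) v Sv
              k , eq = unpair-surjective (i , j)
          in k , subst (λ (i , j) → ¬ Holds (proj₁ (nulls i) j) (at v)) (≡.sym eq) fails }
    }

  open σ-Ideal lawless

  law-null : ∀ law → Null λ v → ¬ Holds law (at v)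
  law-null law = (λ _ → law) , λ _ fails → 0 , fails

  ℝ^Point/lawless : ℓ-Group _ _ _
  ℝ^Point/lawless = Quotient.ℓ-group em Point lawless

  private
    module Q = ℓ-GroupOrder ℝ^Point/lawless

  ι : Carrier → Point → ℝ
  ι x v = at v x

  ι-additive : ∀ x y → ι (x + y) Q.≈ (λ v → ι x v +ʳ ι y v)
  ι-additive x y = law-null (add x y)

  -- Let `b` bound every `ι (f n)` almost everywhere. Outside the union of the countably many
  -- exceptional sets and the failures of the law for `s`, the real `b v` bounds all `at v (f n)`,
  -- so the law itself gives `at v s ≤ʳ b v`.
  ι-σ-continuous : σ-Continuous poset Q.poset ι
  ι-σ-continuous f s isSup =
      (λ n → ⊆-null (λ ¬≤ holds → ¬≤ (proj₁ holds n)) (law-null law))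
    , λ b ub → ⊆-null (λ {v} → cover b {v}) (⋃-null (failures b) λ where
        zero    → law-null law
        (suc n) → ub n)
    where
    law : Law
    law = sup f s isSup
    failures : (Point → ℝ) → ℕ → Pred Point 0ℓ
    failures b zero    v = ¬ Holds law (at v)
    failures b (suc n) v = ¬ (at v (f n) ≤ʳ b v)
    cover : ∀ b → (λ v → ¬ (at v s ≤ʳ b v)) ⊆ ⋃ ℕ (failures b)
    cover b {v} s≰b with em {P = ∃ λ n → failures b n v}
    ... | yes failure = failure
    ... | no none = contradiction
      (proj₂ holds (b v) λ n → decidable-stable em λ f≰b → none (suc n , f≰b)) s≰b
      where
      holds : Holds law (at v)
      holds = decidable-stable em λ fails → none (0 , fails)

  ι-isℓ-homomorphism : Isℓ-Homomorphism G ℝ^Point/lawless ι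
  ι-isℓ-homomorphism = σ-continuous+additive⇒ℓ-homomorphism ι ι-σ-continuous ι-additive
    where open ℓ-Homomorphisms G ℝ^Point/lawless

  -- The laws witnessing that `ι x` vanishes almost everywhere are the list given to `separate`: if
  -- `x ≰ 0`, the resulting `v` obeys them all although `v x` is not 0.
  ι-kernel : ∀ {x} → ι x Q.≈ Q.0# → x ≤ 0#
  ι-kernel {x} (laws , excluded) = decidable-stable em λ x≰0 →
    let v , holds , v≉0 = separate x≰0 laws
        n , fails = excluded (point v) v≉0
    in fails (holds n)

  ι-injective : Injective _≈_ Q._≈_ ι
  ι-injective {x} {y} ιx≈ιy = antisym (order x y ιx≈ιy) (order y x (Q.sym {ι x} {ι y} ιx≈ιy))
    where
    open Isℓ-Homomorphism ι-isℓ-homomorphism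
    open IsGroupHomomorphism isGroupHomomorphism using (homo; ⁻¹-homo)
    order : ∀ x y → ι x Q.≈ ι y → x ≤ y
    order x y eq = x-y≲0⇒x≲y (ι-kernel (begin
      ι (x + - y)         ≈⟨ homo x (- y) ⟩
      ι x Q.+ ι (- y)     ≈⟨ Q.+-cong {ι x} {ι y} {ι (- y)} {Q.- ι y} eq (⁻¹-homo y) ⟩
      ι y Q.+ Q.- ι y     ≈⟨ Q.+-inverseʳ (ι y) ⟩
      Q.0#                ∎))
      where open SetoidReasoning Q.setoid

open ℓ-Group using (Carrier; _≈_; poset)

theorem11p3 : (em : ∀ {a} → ExcludedMiddle a) →
    ∀ {c ℓ₁ ℓ₂} (G : ℓ-Group c ℓ₁ ℓ₂) → DedekindσComplete (poset G) →
    (u : Carrier G) → IsWeakUnit G u →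
    Σ (Set (c ⊔ ℓ₁ ⊔ ℓ₂)) λ X →
    Σ (σ-Ideal X (c ⊔ ℓ₁ ⊔ ℓ₂)) λ I →
    let ℝ^X/I = Quotient.ℓ-group em X I in
    Σ (Carrier G → Carrier ℝ^X/I) λ ι →
    Isℓ-Homomorphism G ℝ^X/I ι
    × Injective (_≈_ G) (_≈_ ℝ^X/I) ι
    × σ-Continuous (poset G) (poset ℝ^X/I) ι
    × _≈_ ℝ^X/I (ι u) (λ _ → 1ʳ)
theorem11p3 em G complete u weakUnit =
  Point , lawless , ι , ι-isℓ-homomorphism , ι-injective , ι-σ-continuous , law-null unit
  where open Representation em G complete u weakUnit
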